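{- Let $G$ be a graph with $\alpha(G)=2$ that is facet-defining and ${\rm LS}_+$-perfect. Then $G$ is an odd antihole, or $G$ is the complete join of one or more odd antiholes and a (possibly empty) clique.
   Context: All graphs are finite and simple; $\alpha(G)$ is the stability number. ${\rm STAB}(G)$ is the convex hull of incidence vectors of stable sets of $G=(V,E)$; $G$ is facet-defining if ${\rm STAB}(G)$ has a facet $a^Tx\le b$ with $a_i\neq 0$ for all $i\in V$ (full support). ${\rm ESTAB}(G)=\{x\in[0,1]^V: x_i+x_j\le 1,\ ij\in E\}$. For convex $K\subseteq[0,1]^n$: $\mathrm{cone}(K)=\{(x_0,x): x=x_0y, y\in K\}$; $M_+(K)$ is the set of symmetric positive semidefinite $(n+1)\times(n+1)$ matrices $Y$ (indices $0,\dots,n$) with $Ye_0=\mathrm{diag}(Y)$, $Ye_i\in\mathrm{cone}(K)$, $Y(e_0-e_i)\in\mathrm{cone}(K)$ for $i=1,\dots,n$; ${\rm LS}_+(K)=\{x\in[0,1]^n:(1,x)^T=Ye_0 \text{ for some } Y\in M_+(K)\}$. $G$ is ${\rm LS}_+$-perfect if ${\rm LS}_+({\rm ESTAB}(G))={\rm STAB}(G)$. An odd antihole is the complement of a chordless cycle of odd length at least 5. The complete join of graphs is their disjoint union with all edges between different parts added. -}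

module Defs where

open import Algebra.Bundles using (CommutativeRing)
import Algebra.Properties.Monoid.Sum as Sum
open import Data.Bool.Base using (if_then_else_)
open import Data.Fin.Base using (Fin; zero; suc; toℕ)
open import Data.Fin.Properties using (_≟_; toℕ<n)
open import Data.Fin.Subset using (Subset; ∣_∣) renaming (_∈_ to _∈ₛ_)
open import Data.Nat.Base as ℕ using (ℕ; zero; suc)
import Data.Nat.Properties as ℕ
open import Data.Nat.DivMod using (_%_; m<n⇒m%n≡m; n%n≡0)
open import Data.Product using (Σ; Σ-syntax; ∃; ∃-syntax; _×_; _,_)
open import Data.Sum using (_⊎_; inj₁; inj₂; swap)
import Data.Vec.Base as Vec
open import Data.Vec.Functional using (Vector)
open import Function.Base using (_∘_)
open import Function.Bundles using (_↔_; _⇔_; Inverse)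
open import Level using (_⊔_; 0ℓ) renaming (suc to lsuc)
open import Relation.Binary.Core using (Rel)
open import Relation.Binary.Definitions using (Decidable; Symmetric)
open import Relation.Binary.PropositionalEquality
  using (_≡_; _≢_; refl; sym; trans; cong)
open import Relation.Binary.Structures using (IsDecTotalOrder)
open import Relation.Nullary using (¬_; yes; no; ¬?; contradiction)
open import Relation.Nullary.Decidable using (map′; _×-dec_; _⊎-dec_)
open import Relation.Unary using (Pred; _∈_; _≐_)

-- Finite simple graphs are those with V = Fin n.
record Graph (V : Set) : Set₁ where
  infix 4 _~_
  field
    _~_      : Rel V 0ℓ
    ~-dec    : Decidable _~_
    ~-sym    : Symmetric _~_
    ~-irrefl : ∀ {v} → ¬ (v ~ v)

open Graph using (~-dec; ~-sym; ~-irrefl)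

Adj : ∀ {V} → Graph V → Rel V 0ℓ
Adj = Graph._~_

infix 4 _≅_
_≅_ : ∀ {V W} → Graph V → Graph W → Set
_≅_ {V} {W} G H =
  Σ[ f ∈ V ↔ W ] ∀ u v → Adj G u v ⇔ Adj H (Inverse.to f u) (Inverse.to f v)

complement : ∀ {n} → Graph (Fin n) → Graph (Fin n)
complement G = record
  { _~_      = λ u v → u ≢ v × ¬ Adj G u v
  ; ~-dec    = λ u v → ¬? (u ≟ v) ×-dec ¬? (~-dec G u v)
  ; ~-sym    = λ (u≢v , ¬uv) → u≢v ∘ sym , ¬uv ∘ ~-sym G
  ; ~-irrefl = λ (v≢v , _) → v≢v refl
  }

CyclicSuc : ∀ {k} → Rel (Fin (3 ℕ.+ k)) 0ℓ
CyclicSuc {k} i j = toℕ j ≡ suc (toℕ i) % (3 ℕ.+ k)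

CyclicSuc-irrefl : ∀ {k} (i : Fin (3 ℕ.+ k)) → ¬ CyclicSuc i i
CyclicSuc-irrefl {k} i i≡1+i with suc (toℕ i) ℕ.≟ 3 ℕ.+ k
... | no 1+i≢n = ℕ.m≢1+m+n (toℕ i)
  (trans i≡1+i (trans (m<n⇒m%n≡m (ℕ.≤∧≢⇒< (toℕ<n i) 1+i≢n))
                      (cong suc (sym (ℕ.+-identityʳ (toℕ i))))))
... | yes 1+i≡n = contradiction
  (trans (sym 1+i≡n)
         (cong suc (trans i≡1+i (trans (cong (_% (3 ℕ.+ k)) 1+i≡n) (n%n≡0 (3 ℕ.+ k))))))
  λ ()

-- The cycle of length 3 + k.
cycle : ∀ k → Graph (Fin (3 ℕ.+ k))
cycle k = record
  { _~_      = λ i j → CyclicSuc i j ⊎ CyclicSuc j i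
  ; ~-dec    = λ i j → (toℕ j ℕ.≟ _) ⊎-dec (toℕ i ℕ.≟ _)
  ; ~-sym    = swap
  ; ~-irrefl = λ { {i} (inj₁ p) → CyclicSuc-irrefl i p
                 ; {i} (inj₂ p) → CyclicSuc-irrefl i p }
  }

-- The odd lengths at least 5 are exactly 3 + (2 + 2 * k).
IsOddAntihole : ∀ {V} → Graph V → Set
IsOddAntihole G = ∃[ k ] G ≅ complement (cycle (2 ℕ.+ 2 ℕ.* k))

IsClique : ∀ {V} → Graph V → Set
IsClique G = ∀ u v → u ≢ v → Adj G u v

module _ {r : ℕ} {V : Fin r → Set} (H : ∀ i → Graph (V i)) where

  data JoinAdj : Rel (Σ (Fin r) V) 0ℓ where
    across : ∀ {i j u v} → i ≢ j → JoinAdj (i , u) (j , v)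
    within : ∀ {i u v} → Adj (H i) u v → JoinAdj (i , u) (i , v)

  completeJoin : Graph (Σ (Fin r) V)
  completeJoin = record
    { _~_ = JoinAdj ; ~-dec = dec ; ~-sym = symm ; ~-irrefl = irr }
    where
    symm : Symmetric JoinAdj
    symm (across i≢j) = across (i≢j ∘ sym)
    symm (within uv)  = within (~-sym (H _) uv)

    irr : ∀ {p} → ¬ JoinAdj p p
    irr (across i≢i) = i≢i refl
    irr (within uu)  = ~-irrefl (H _) uu

    unwithin : ∀ {i u v} → JoinAdj (i , u) (i , v) → Adj (H i) u v
    unwithin (across i≢i) = contradiction refl i≢i
    unwithin (within uv)  = uv

    dec : Decidable JoinAdj
    dec (i , u) (j , v) with i ≟ j
    ... | no i≢j   = yes (across i≢j)
    ... | yes refl = map′ within unwithin (~-dec (H i) u v)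

-- Part zero is the clique, which is empty when size zero ≡ 0; the k + 1
-- remaining parts are the antiholes.
IsJoinOfOddAntiholesAndClique : ∀ {V} → Graph V → Set₁
IsJoinOfOddAntiholesAndClique G =
  ∃[ k ] Σ[ size ∈ (Fin (2 ℕ.+ k) → ℕ) ] Σ[ H ∈ (∀ i → Graph (Fin (size i))) ]
    IsClique (H zero) × (∀ i → IsOddAntihole (H (suc i))) × G ≅ completeJoin H

module _ {n : ℕ} (G : Graph (Fin n)) where

  Stable : Subset n → Set
  Stable S = ∀ u v → u ∈ₛ S → v ∈ₛ S → ¬ Adj G u v

  -- α(G) = k
  HasStabilityNumber : ℕ → Set
  HasStabilityNumber k =
    (∃[ S ] Stable S × ∣ S ∣ ≡ k) × (∀ S → Stable S → ∣ S ∣ ℕ.≤ k)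

-- The real numbers, characterised up to isomorphism (classically) as a
-- Dedekind-complete ordered field.  Decidability of the order is the
-- classical trichotomy law.
record RealField c ℓ₁ ℓ₂ : Set (lsuc (c ⊔ ℓ₁ ⊔ ℓ₂)) where
  field
    commutativeRing : CommutativeRing c ℓ₁

  open CommutativeRing commutativeRing public
    renaming (refl to ≈-refl; sym to ≈-sym; trans to ≈-trans)

  infix 4 _≤_
  field
    _≤_             : Rel Carrier ℓ₂
    isDecTotalOrder : IsDecTotalOrder _≈_ _≤_
    0≉1             : ¬ (0# ≈ 1#)
    inverse         : ∀ x → ¬ (x ≈ 0#) → ∃[ y ] x * y ≈ 1#
    +-monoˡ-≤       : ∀ z {x y} → x ≤ y → x + z ≤ y + z
    *-nonNeg        : ∀ {x y} → 0# ≤ x → 0# ≤ y → 0# ≤ x * y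

  UpperBound : Pred Carrier (c ⊔ ℓ₁ ⊔ ℓ₂) → Carrier → Set (c ⊔ ℓ₁ ⊔ ℓ₂)
  UpperBound A b = ∀ {x} → x ∈ A → x ≤ b

  field
    supremum : (A : Pred Carrier (c ⊔ ℓ₁ ⊔ ℓ₂)) →
               ∃ A → ∃ (UpperBound A) →
               ∃[ s ] UpperBound A s × (∀ b → UpperBound A b → s ≤ b)

  open IsDecTotalOrder isDecTotalOrder public
    using (total; _≤?_)
    renaming ( _≟_ to _≈?_; reflexive to ≤-reflexive
             ; refl to ≤-refl; trans to ≤-trans; antisym to ≤-antisym )

module _ {c ℓ₁ ℓ₂} (R : RealField c ℓ₁ ℓ₂) where

  open RealField R hiding (zero)
  open Sum +-monoid using (sum)

  Point : ℕ → Set c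
  Point n = Vector Carrier n

  dot : ∀ {n} → Point n → Point n → Carrier
  dot a x = sum (λ i → a i * x i)

  ConvexHull : ∀ {n ℓ} → Pred (Point n) ℓ → Pred (Point n) (c ⊔ ℓ₁ ⊔ ℓ₂ ⊔ ℓ)
  ConvexHull {n} A x =
    ∃[ k ] Σ[ p ∈ (Fin k → Point n) ] Σ[ w ∈ Vector Carrier k ]
      (∀ i → p i ∈ A) × (∀ i → 0# ≤ w i) × sum w ≈ 1# ×
      (∀ j → x j ≈ sum (λ i → w i * p i j))

  AffinelyIndependent : ∀ {n k} → (Fin k → Point n) → Set (c ⊔ ℓ₁)
  AffinelyIndependent {k = k} p =
    (w : Vector Carrier k) → sum w ≈ 0# →
    (∀ j → sum (λ i → w i * p i j) ≈ 0#) → ∀ i → w i ≈ 0#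

  HasDimension : ∀ {n ℓ} → Pred (Point n) ℓ → ℕ → Set (c ⊔ ℓ₁ ⊔ ℓ)
  HasDimension {n} K d =
    (Σ[ p ∈ (Fin (suc d) → Point n) ] (∀ i → p i ∈ K) × AffinelyIndependent p) ×
    ((p : Fin (2 ℕ.+ d) → Point n) → (∀ i → p i ∈ K) → ¬ AffinelyIndependent p)

  -- Dimensions are natural numbers, so the empty face of a single point does
  -- not count as a facet.
  IsFacet : ∀ {n ℓ} → Pred (Point n) ℓ → Point n → Carrier → Set (c ⊔ ℓ₁ ⊔ ℓ₂ ⊔ ℓ)
  IsFacet P a b =
    (∀ x → x ∈ P → dot a x ≤ b) ×
    (∃[ d ] HasDimension P (suc d) ×
            HasDimension (λ x → x ∈ P × dot a x ≈ b) d)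

  InUnitCube : ∀ {n} → Pred (Point n) ℓ₂
  InUnitCube x = ∀ i → 0# ≤ x i × x i ≤ 1#

  -- Index zero of Fin (suc n) is the homogenising coordinate x₀.
  cone : ∀ {n ℓ} → Pred (Point n) ℓ → Pred (Point (suc n)) (c ⊔ ℓ₁ ⊔ ℓ)
  cone K z = ∃[ y ] y ∈ K × (∀ i → z (suc i) ≈ z zero * y i)

  Matrix : ℕ → Set c
  Matrix m = Fin m → Fin m → Carrier

  column : ∀ {m} → Matrix m → Fin m → Point m
  column Y i j = Y j i

  PositiveSemidefinite : ∀ {m} → Matrix m → Set (c ⊔ ℓ₁ ⊔ ℓ₂)
  PositiveSemidefinite {m} Y =
    (∀ i j → Y i j ≈ Y j i) ×
    ((z : Point m) → 0# ≤ sum (λ i → sum (λ j → z i * Y i j * z j)))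

  M₊ : ∀ {n ℓ} → Pred (Point n) ℓ → Pred (Matrix (suc n)) (c ⊔ ℓ₁ ⊔ ℓ₂ ⊔ ℓ)
  M₊ K Y =
    PositiveSemidefinite Y ×
    (∀ j → column Y zero j ≈ Y j j) ×
    (∀ i → column Y (suc i) ∈ cone K ×
           (λ j → column Y zero j - column Y (suc i) j) ∈ cone K)

  LS₊ : ∀ {n ℓ} → Pred (Point n) ℓ → Pred (Point n) (c ⊔ ℓ₁ ⊔ ℓ₂ ⊔ ℓ)
  LS₊ K x =
    InUnitCube x ×
    (∃[ Y ] Y ∈ M₊ K × column Y zero zero ≈ 1# ×
            (∀ i → column Y zero (suc i) ≈ x i))

  incidence : ∀ {n} → Subset n → Point n
  incidence S i = if Vec.lookup S i then 1# else 0#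

  module _ {n : ℕ} (G : Graph (Fin n)) where

    STAB : Pred (Point n) (c ⊔ ℓ₁ ⊔ ℓ₂)
    STAB = ConvexHull (λ x → ∃[ S ] Stable G S × (∀ i → x i ≈ incidence S i))

    ESTAB : Pred (Point n) ℓ₂
    ESTAB x = InUnitCube x × (∀ i j → Adj G i j → x i + x j ≤ 1#)

    FacetDefining : Set (c ⊔ ℓ₁ ⊔ ℓ₂)
    FacetDefining =
      ∃[ a ] ∃[ b ] IsFacet STAB a b × (∀ i → ¬ (a i ≈ 0#))

    LS₊-Perfect : Set (c ⊔ ℓ₁ ⊔ ℓ₂)
    LS₊-Perfect = LS₊ ESTAB ≐ STAB

{-# OPTIONS --safe #-}

-- Write H for the complement of G; since α(G) = 2, H is triangle-free.
--
-- Polyhedral part.  The stable sets on a full-support facet a·x ≤ b with a > 0 are edges or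
-- isolated vertices of H.  If z vanishes on isolated vertices of H and z u + z w = 0 along the
-- edges of H, then z·x = 0 is a second linear equation for the facet, so z = 0.  For z the signed
-- indicator of a bipartition, this says that no component of H with an edge is bipartite.
--
-- Semidefinite part.  Let C be an odd cycle of length m ≥ 5 in H and let v ∉ C be H-adjacent
-- to t ∈ C.  The symmetric matrix with the nonzero entries (up to symmetry and scaling)
--   Y₀₀ = s m + 3,   Y₀ᵤ = Yᵤᵤ = 2 s and Yᵤᵤ′ = s on C,   Y₀ᵥ = Yᵥᵥ = Yᵥₜ = 8
-- is feasible for LS₊ when s is large, and its point has coordinate sum
-- (2 s m + 8) / (s m + 3) > 2 = α(G).  So LS₊-perfection forces every odd cycle of H to span a
-- component of H.
--
-- A shortest odd closed walk in a component of H with an edge is therefore an induced odd cycle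
-- which is the whole component; the isolated vertices of H form the clique.
module Submission where

open import Defs
import Algebra.Properties.Ring as RingProperties
import Algebra.Properties.Semiring.Mult as Mult
import Algebra.Properties.Semiring.Sum as SemiringSum
import Algebra.Solver.Ring
open import Algebra.Bundles using (RawRing)
open import Algebra.Solver.Ring.AlmostCommutativeRing
  using (fromCommutativeRing; _-Raw-AlmostCommutative⟶_)
open import Data.Bool.Base using (Bool; true; false; not; _xor_; if_then_else_)
import Data.Bool.Properties as Bool
open import Data.Fin.Base as Fin
  using (Fin; zero; suc; toℕ; fromℕ; inject₁; inject≤; punchIn; punchOut)
open import Data.Fin.Induction using (>-weakInduction)
open import Data.Fin.Properties
  using ( _≟_; any?; <-cmp; suc-injective; toℕ-injective; toℕ-fromℕ; toℕ-inject₁; toℕ<n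
        ; fromℕ≢inject₁; inject₁-injective; inject≤-injective; punchIn-punchOut; injective⇒≤ )
  renaming (_<?_ to _<ᶠ?_)
open import Data.Fin.Subset using (Subset; ∣_∣; ⁅_⁆; _∩_; _∪_; ∁)
  renaming (_∈_ to _∈ₛ_; _∉_ to _∉ₛ_; ⊥ to ∅)
open import Data.Fin.Subset.Properties
  using ( ∉⊥; ∣⊥∣≡0; x∈⁅x⁆; x∈⁅y⁆⇒x≡y; ∣⁅x⁆∣≡1; _∈?_; x∈p∩q⁺; x∈p∩q⁻; x∈p∪q⁻; x∈p∪q⁺; p⊆p∪q
        ; x∉p⇒x∈∁p; x∈∁p⇒x∉p; p⊆q⇒∣p∣≤∣q∣; p⊂q⇒∣p∣<∣q∣ )
open import Data.Integer.Base as ℤ using (ℤ)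
import Data.Integer.Properties as ℤ
open import Data.Maybe.Base using (Maybe; just; nothing)
open import Data.Maybe.Properties using (≡-dec; just-injective)
open import Data.Nat.Base as ℕ using (ℕ; zero; suc; z≤n; s≤s)
open import Data.Nat.DivMod using (_%_; m<n⇒m%n≡m; n%n≡0)
open import Data.Nat.Induction using (<-wellFounded)
import Data.Nat.Properties as ℕ
open import Data.Nat.Solver using (module +-*-Solver)
open import Data.Product using (Σ; Σ-syntax; ∃-syntax; _×_; _,_; proj₁; proj₂)
open import Data.Sum using (_⊎_; inj₁; inj₂; [_,_])
open import Data.Vec.Base using ([]; _∷_; lookup)
open import Data.Vec.Functional as Vector using (Vector; insertAt; updateAt)
open import Data.Vec.Functional.Properties
  using (insertAt-lookup; insertAt-punchIn; updateAt-updates; updateAt-minimal)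
open import Data.Vec.Properties using ([]=⇒lookup; lookup⇒[]=)
open import Function.Base using (_∘_; const)
open import Function.Bundles using (_↔_; mk↔ₛ′; mk⇔)
open import Function.Construct.Identity using (↔-id; ⇔-id)
open import Function.Definitions using (Injective)
open import Induction.WellFounded using (Acc; acc)
open import Relation.Binary.Bundles using (Poset)
open import Relation.Binary.Definitions using (tri<; tri≈; tri>)
open import Relation.Binary.PropositionalEquality as ≡
  using (_≡_; _≢_; refl; sym; trans; cong; subst)
import Relation.Binary.Reasoning.PartialOrder as PosetReasoning
import Relation.Binary.Reasoning.Setoid as SetoidReasoning
open import Relation.Binary.Structures using (IsDecTotalOrder)
open import Relation.Nullary using (¬_; Dec; yes; no; does; contradiction; ¬?)
open import Relation.Nullary.Decidable
  using (dec-true; dec-false; decidable-stable; _×-dec_; _⊎-dec_)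
open import Relation.Unary using (Decidable)

-- The consecutive pairs of C have coordinate sum exactly 2, so their moment matrix is feasible
-- without any excess; a perturbation T has to supply it. Column v of T is 8 times the stable pair
-- {v, t}, but T leaves the entries at (0, t) and (t, t) zero and pays only 3 at (0, 0). This makes
-- T indefinite, and oddness of C repairs it: the sum over the pairs vanishes at z only if z_u = -
-- z_0 / 2 on all of C, and away from these z a large multiple s outweighs the defect. At such z the
-- form of T is 8 (z_v + z_0 / 2)^2 + (T_00 - 2) z_0^2, which asks for T_00 >= 2, while the excess 8
-- - 2 T_00 of the coordinate sum over twice the entry at (0, 0) has to be positive; hence the value
-- 3. The cone conditions come down to counting pairs of C. In the columns of e_0 - e_i a spare
-- multiple of s must absorb up to 16, which is where m >= 5 and s >= 16 enter.

-- Ordered-field arithmetic and finite sums.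

module FieldProperties {c ℓ₁ ℓ₂} (R : RealField c ℓ₁ ℓ₂) where

  open import Data.Integer.Base using (+_; -[1+_]) public

  open RealField R hiding (zero)
  open RingProperties ring using (-‿distribˡ-*; -‿distribʳ-*; -‿+-comm; -‿involutive; -0#≈0#)
  open Mult semiring using (×-homo-+; ×1-homo-*) renaming (_×_ to _·_)
  open SemiringSum semiring public
    using (sum; sum-cong-≋; ∑-distrib-+; ∑-comm; sum-remove; *-distribˡ-sum; *-distribʳ-sum)

  private module ≈ = SetoidReasoning setoid

  -- The certificate matrix has natural-number entries; its inequalities are proved in ℕ and carried
  -- to the field by this map.
  ι : ℕ → Carrier
  ι n = n · 1#

  ι-+ : ∀ m n → ι (m ℕ.+ n) ≈ ι m + ι n
  ι-+ = ×-homo-+ 1#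

  ι-* : ∀ m n → ι (m ℕ.* n) ≈ ι m * ι n
  ι-* = ×1-homo-*

  ι-1 : ι 1 ≈ 1#
  ι-1 = +-identityʳ 1#

  ιℤ : ℤ → Carrier
  ιℤ (+ n)    = ι n
  ιℤ -[1+ n ] = - ι (suc n)

  ιℤ-⊖ : ∀ m n → ιℤ (m ℤ.⊖ n) ≈ ι m - ι n
  ιℤ-⊖ m zero = ≈-sym (≈-trans (+-congˡ -0#≈0#) (+-identityʳ _))
  ιℤ-⊖ zero (suc n) = ≈-sym (+-identityˡ _)
  ιℤ-⊖ (suc m) (suc n) = ≈.begin
    ιℤ (suc m ℤ.⊖ suc n)           ≈.≡⟨ ≡.cong ιℤ (ℤ.[1+m]⊖[1+n]≡m⊖n m n) ⟩
    ιℤ (m ℤ.⊖ n)                   ≈.≈⟨ ιℤ-⊖ m n ⟩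
    ι m - ι n                      ≈.≈⟨ +-congʳ (+-identityʳ _) ⟨
    ι m + 0# - ι n                 ≈.≈⟨ +-congʳ (+-congˡ (-‿inverseʳ 1#)) ⟨
    ι m + (1# - 1#) - ι n          ≈.≈⟨ +-congʳ (+-assoc _ _ _) ⟨
    ι m + 1# - 1# - ι n            ≈.≈⟨ +-assoc _ _ _ ⟩
    ι m + 1# + (- 1# - ι n)        ≈.≈⟨ +-cong (+-comm _ _) (-‿+-comm _ _) ⟩
    ι (suc m) - ι (suc n)          ≈.∎

  ιℤ-+ : ∀ i j → ιℤ (i ℤ.+ j) ≈ ιℤ i + ιℤ j
  ιℤ-+ (+ m) (+ n) = ι-+ m n
  ιℤ-+ (+ m) -[1+ n ] = ιℤ-⊖ m (suc n)
  ιℤ-+ -[1+ m ] (+ n) = ≈-trans (ιℤ-⊖ n (suc m)) (+-comm _ _)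
  ιℤ-+ -[1+ m ] -[1+ n ] = ≈-trans
    (-‿cong (≈-trans (reflexive (≡.cong (ι ∘ suc) (≡.sym (ℕ.+-suc m n)))) (ι-+ (suc m) (suc n))))
    (≈-sym (-‿+-comm _ _))

  ιℤ-* : ∀ i j → ιℤ (i ℤ.* j) ≈ ιℤ i * ιℤ j
  ιℤ-* (+ m) (+ n) = ≈-trans (reflexive (≡.cong ιℤ (≡.sym (ℤ.pos-* m n)))) (ι-* m n)
  ιℤ-* (+ zero) -[1+ n ] = ≈-sym (zeroˡ _)
  ιℤ-* (+ suc m) -[1+ n ] = ≈-trans (-‿cong (ι-* (suc m) (suc n))) (-‿distribʳ-* _ _)
  ιℤ-* -[1+ m ] (+ zero) = ≈-trans (reflexive (≡.cong ιℤ (ℤ.*-zeroʳ -[1+ m ]))) (≈-sym (zeroʳ _))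
  ιℤ-* -[1+ m ] (+ suc n) = ≈-trans (-‿cong (ι-* (suc m) (suc n))) (-‿distribˡ-* _ _)
  ιℤ-* -[1+ m ] -[1+ n ] = ≈.begin
    ι (suc m ℕ.* suc n)             ≈.≈⟨ ι-* (suc m) (suc n) ⟩
    ι (suc m) * ι (suc n)           ≈.≈⟨ -‿involutive _ ⟨
    - (- (ι (suc m) * ι (suc n)))   ≈.≈⟨ -‿cong (-‿distribˡ-* _ _) ⟩
    - (- ι (suc m) * ι (suc n))     ≈.≈⟨ -‿distribʳ-* _ _ ⟩
    - ι (suc m) * - ι (suc n)       ≈.∎

  ιℤ-neg : ∀ i → ιℤ (ℤ.- i) ≈ - ιℤ i
  ιℤ-neg (+ zero) = ≈-sym -0#≈0#
  ιℤ-neg (+ suc n) = ≈-refl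
  ιℤ-neg -[1+ n ] = ≈-sym (-‿involutive _)

  ℤ-rawRing : RawRing _ _
  ℤ-rawRing = record
    { Carrier = ℤ ; _≈_ = _≡_ ; _+_ = ℤ._+_ ; _*_ = ℤ._*_ ; -_ = ℤ.-_ ; 0# = + 0 ; 1# = + 1 }

  ιℤ-morphism : ℤ-rawRing -Raw-AlmostCommutative⟶ fromCommutativeRing commutativeRing
  ιℤ-morphism = record
    { ⟦_⟧    = ιℤ
    ; +-homo = ιℤ-+
    ; *-homo = ιℤ-*
    ; -‿homo = ιℤ-neg
    ; 0-homo = ≈-refl
    ; 1-homo = ι-1
    }

  ιℤ-equal? : ∀ i j → Maybe (ιℤ i ≈ ιℤ j)
  ιℤ-equal? i j with i ℤ.≟ j
  ... | yes i≡j = just (reflexive (≡.cong ιℤ i≡j))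
  ... | no  _   = nothing

  -- The solver has to compute with coefficients, so they are taken in ℤ and interpreted by `ιℤ`
  -- instead of lying in the abstract field.
  module Solver = Algebra.Solver.Ring
    ℤ-rawRing (fromCommutativeRing commutativeRing) ιℤ-morphism ιℤ-equal?
  open Solver using (solve; _:+_; _:*_; _:-_; :-_; _:=_; con)

  poset : Poset c ℓ₁ ℓ₂
  poset = record { isPartialOrder = IsDecTotalOrder.isPartialOrder isDecTotalOrder }

  module ≤-Reasoning = PosetReasoning poset
  open ≤-Reasoning

  ≤-resp-≈ : ∀ {x y u v} → x ≈ u → y ≈ v → x ≤ y → u ≤ v
  ≤-resp-≈ x≈u y≈v x≤y = ≤-trans (≤-reflexive (≈-sym x≈u)) (≤-trans x≤y (≤-reflexive y≈v))

  +-monoʳ-≤ : ∀ z {x y} → x ≤ y → z + x ≤ z + y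
  +-monoʳ-≤ z = ≤-resp-≈ (+-comm _ _) (+-comm _ _) ∘ +-monoˡ-≤ z

  +-mono-≤ : ∀ {x y u v} → x ≤ y → u ≤ v → x + u ≤ y + v
  +-mono-≤ x≤y u≤v = ≤-trans (+-monoˡ-≤ _ x≤y) (+-monoʳ-≤ _ u≤v)

  ≤⇒0≤- : ∀ {x y} → x ≤ y → 0# ≤ y - x
  ≤⇒0≤- {x} = ≤-resp-≈ (-‿inverseʳ x) ≈-refl ∘ +-monoˡ-≤ (- x)

  0≤-⇒≤ : ∀ {x y} → 0# ≤ y - x → x ≤ y
  0≤-⇒≤ {x} {y} =
    ≤-resp-≈ (+-identityˡ x) (solve 2 (λ x y → y :- x :+ x := y) ≈-refl x y) ∘ +-monoˡ-≤ x

  x≤0⇒0≤-x : ∀ {x} → x ≤ 0# → 0# ≤ - x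
  x≤0⇒0≤-x = ≤-resp-≈ ≈-refl (+-identityˡ _) ∘ ≤⇒0≤-

  +-cancelʳ-≤ : ∀ z {x y} → x + z ≤ y + z → x ≤ y
  +-cancelʳ-≤ z {x} {y} x+z≤y+z = 0≤-⇒≤
    (≤-resp-≈ ≈-refl (solve 3 (λ x y z → y :+ z :- (x :+ z) := y :- x) ≈-refl x y z)
              (≤⇒0≤- x+z≤y+z))

  *-monoˡ-≤ : ∀ {x y z} → 0# ≤ z → x ≤ y → z * x ≤ z * y
  *-monoˡ-≤ {x} {y} {z} 0≤z x≤y = 0≤-⇒≤
    (≤-resp-≈ ≈-refl (solve 3 (λ x y z → z :* (y :- x) := z :* y :- z :* x) ≈-refl x y z)
              (*-nonNeg 0≤z (≤⇒0≤- x≤y)))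

  +-nonNeg : ∀ {x y} → 0# ≤ x → 0# ≤ y → 0# ≤ x + y
  +-nonNeg 0≤x 0≤y = ≤-resp-≈ (+-identityˡ 0#) ≈-refl (+-mono-≤ 0≤x 0≤y)

  0≤x*x : ∀ x → 0# ≤ x * x
  0≤x*x x with total 0# x
  ... | inj₁ 0≤x = *-nonNeg 0≤x 0≤x
  ... | inj₂ x≤0 = ≤-resp-≈ ≈-refl (solve 1 (λ x → (:- x) :* (:- x) := x :* x) ≈-refl x)
                     (*-nonNeg (x≤0⇒0≤-x x≤0) (x≤0⇒0≤-x x≤0))

  0≤1 : 0# ≤ 1#
  0≤1 = ≤-resp-≈ ≈-refl (*-identityˡ 1#) (0≤x*x 1#)

  1≰0 : ¬ (1# ≤ 0#)
  1≰0 1≤0 = 0≉1 (≤-antisym 0≤1 1≤0)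

  ι-mono : ∀ {m n} → m ℕ.≤ n → ι m ≤ ι n
  ι-mono {n = zero}  ℕ.z≤n = ≤-refl
  ι-mono {n = suc n} ℕ.z≤n = +-nonNeg 0≤1 (ι-mono {n = n} ℕ.z≤n)
  ι-mono (ℕ.s≤s m≤n) = +-monoʳ-≤ 1# (ι-mono m≤n)

  0≤ι : ∀ n → 0# ≤ ι n
  0≤ι n = ι-mono {n = n} ℕ.z≤n

  ι-cancel-≤ : ∀ {m n} → ι m ≤ ι n → m ℕ.≤ n
  ι-cancel-≤ {zero} _ = ℕ.z≤n
  ι-cancel-≤ {suc m} {zero} 1+m≤0 = contradiction
    (≤-trans (≤-resp-≈ ι-1 ≈-refl (ι-mono (ℕ.s≤s (ℕ.z≤n {m})))) 1+m≤0) 1≰0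
  ι-cancel-≤ {suc m} {suc n} 1+m≤1+n =
    ℕ.s≤s (ι-cancel-≤ (+-cancelʳ-≤ 1# (≤-resp-≈ (+-comm _ _) (+-comm _ _) 1+m≤1+n)))

  x*y≈0⇒y≈0 : ∀ {x y} → ¬ (x ≈ 0#) → x * y ≈ 0# → y ≈ 0#
  x*y≈0⇒y≈0 {x} {y} x≉0 xy≈0 with inverse x x≉0
  ... | x⁻¹ , xx⁻¹≈1 = ≈.begin
    y             ≈.≈⟨ *-identityˡ y ⟨
    1# * y        ≈.≈⟨ *-congʳ xx⁻¹≈1 ⟨
    x * x⁻¹ * y   ≈.≈⟨ solve 3 (λ x i y → x :* i :* y := i :* (x :* y)) ≈-refl x x⁻¹ y ⟩
    x⁻¹ * (x * y) ≈.≈⟨ *-congˡ xy≈0 ⟩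
    x⁻¹ * 0#      ≈.≈⟨ zeroʳ x⁻¹ ⟩
    0#            ≈.∎

  inverse-nonNeg : ∀ {x y} → 0# ≤ x → x * y ≈ 1# → 0# ≤ y
  inverse-nonNeg {x} {y} 0≤x xy≈1 with total 0# y
  ... | inj₁ 0≤y = 0≤y
  ... | inj₂ y≤0 = contradiction (0≤-⇒≤ (≤-resp-≈ ≈-refl eq (*-nonNeg 0≤x (x≤0⇒0≤-x y≤0)))) 1≰0
    where
    eq : x * - y ≈ 0# - 1#
    eq = ≈-trans (solve 2 (λ x y → x :* (:- y) := con (+ 0) :- x :* y) ≈-refl x y)
                 (+-congˡ (-‿cong xy≈1))

  x+y≈0,0≤⇒x≈0 : ∀ {x y} → 0# ≤ x → 0# ≤ y → x + y ≈ 0# → x ≈ 0#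
  x+y≈0,0≤⇒x≈0 {x} {y} 0≤x 0≤y x+y≈0 =
    ≤-antisym (≤-trans (≤-resp-≈ (+-identityʳ x) ≈-refl (+-monoʳ-≤ x 0≤y)) (≤-reflexive x+y≈0)) 0≤x

  sum-mono : ∀ {n} {f g : Vector Carrier n} → (∀ i → f i ≤ g i) → sum f ≤ sum g
  sum-mono {zero}  f≤g = ≤-refl
  sum-mono {suc n} f≤g = +-mono-≤ (f≤g zero) (sum-mono (f≤g ∘ suc))

  sum-zero : ∀ {n} {f : Vector Carrier n} → (∀ i → f i ≈ 0#) → sum f ≈ 0#
  sum-zero {zero}  f≈0 = ≈-refl
  sum-zero {suc n} f≈0 = ≈-trans (+-cong (f≈0 zero) (sum-zero (f≈0 ∘ suc))) (+-identityˡ 0#)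

  sum-nonNeg : ∀ {n} {f : Vector Carrier n} → (∀ i → 0# ≤ f i) → 0# ≤ sum f
  sum-nonNeg {n} 0≤f =
    ≤-trans (≤-reflexive (≈-sym (sum-zero {n} {λ _ → 0#} (λ _ → ≈-refl)))) (sum-mono 0≤f)

  sum-nonNeg-≈0 : ∀ {n} {f : Vector Carrier n} → (∀ i → 0# ≤ f i) → sum f ≈ 0# → ∀ i → f i ≈ 0#
  sum-nonNeg-≈0 0≤f Σf≈0 zero = x+y≈0,0≤⇒x≈0 (0≤f zero) (sum-nonNeg (0≤f ∘ suc)) Σf≈0
  sum-nonNeg-≈0 0≤f Σf≈0 (suc i) = sum-nonNeg-≈0 (0≤f ∘ suc)
    (x+y≈0,0≤⇒x≈0 (sum-nonNeg (0≤f ∘ suc)) (0≤f zero) (≈-trans (+-comm _ _) Σf≈0)) i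

  sum-single : ∀ {n} {f : Vector Carrier n} i → (∀ j → j ≢ i → f j ≈ 0#) → sum f ≈ f i
  sum-single zero f≈0 =
    ≈-trans (+-congˡ (sum-zero (λ j → f≈0 (suc j) (λ ())))) (+-identityʳ _)
  sum-single (suc i) f≈0 =
    ≈-trans (+-cong (f≈0 zero (λ ())) (sum-single i (λ j j≢i → f≈0 (suc j) (j≢i ∘ suc-injective))))
            (+-identityˡ _)

  sum-pair : ∀ {n} {f : Vector Carrier n} i j → i ≢ j →
             (∀ k → k ≢ i → k ≢ j → f k ≈ 0#) → sum f ≈ f i + f j
  sum-pair zero zero i≢j f≈0 = contradiction ≡.refl i≢j
  sum-pair zero (suc j) i≢j f≈0 =
    +-congˡ (sum-single j (λ k k≢j → f≈0 (suc k) (λ ()) (k≢j ∘ suc-injective)))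
  sum-pair (suc i) zero i≢j f≈0 = ≈-trans
    (+-congˡ (sum-single i (λ k k≢i → f≈0 (suc k) (k≢i ∘ suc-injective) (λ ()))))
    (+-comm _ _)
  sum-pair (suc i) (suc j) i≢j f≈0 = ≈-trans
    (+-cong (f≈0 zero (λ ()) (λ ()))
            (sum-pair i j (i≢j ∘ ≡.cong suc)
              (λ k k≢i k≢j → f≈0 (suc k) (k≢i ∘ suc-injective) (k≢j ∘ suc-injective))))
    (+-identityˡ _)

-- Homogeneous linear systems and affine dependence.

module LinearAlgebra {c ℓ₁ ℓ₂} (R : RealField c ℓ₁ ℓ₂) where

  open RealField R hiding (zero)
  open FieldProperties R
  open Solver using (solve; _:+_; _:*_; _:-_; :-_; _:=_; con)
  open SetoidReasoning setoid

  -- Gaussian elimination on row `zero`. A zero row costs only an equation; otherwise a pivot at `i`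
  -- removes one equation and one unknown, and `vᵢ` is the back-substituted value of that unknown.
  kernel : ∀ m {N} (A : Fin m → Fin N → Carrier) → m ℕ.< N →
           Σ[ w ∈ Vector Carrier N ]
             (∃[ i ] ¬ (w i ≈ 0#)) × (∀ r → sum (λ i → w i * A r i) ≈ 0#)
  kernel zero {suc N} A m<N = (λ _ → 1#) , (zero , 0≉1 ∘ ≈-sym) , λ ()
  kernel (suc m) {suc N} A (ℕ.s≤s m<N) with any? (λ i → ¬? (A zero i ≈? 0#))
  ... | no A₀≈0 with kernel m (A ∘ suc) (ℕ.m<n⇒m<1+n m<N)
  ...   | w , w≉0 , wA≈0 = w , w≉0 , λ where
            zero → sum-zero λ i → ≈-trans
              (*-congˡ (decidable-stable (A zero i ≈? 0#) (λ A₀ᵢ≉0 → A₀≈0 (i , A₀ᵢ≉0)))) (zeroʳ (w i))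
            (suc r) → wA≈0 r
  kernel (suc m) {suc N} A (ℕ.s≤s m<N) | yes (i , A₀ᵢ≉0)
    with inverse (A zero i) A₀ᵢ≉0
  ... | α , A₀ᵢα≈1
    with kernel m (λ r j → A (suc r) (punchIn i j) - A zero (punchIn i j) * (α * A (suc r) i)) m<N
  ...   | w , (k , wₖ≉0) , wA≈0 = v , (punchIn i k , wₖ≉0 ∘ ≈-trans (≈-sym (v-punchIn k))) , vA≈0
    where
    Σ₀ : ∀ r → Carrier
    Σ₀ r = sum (λ j → w j * A r (punchIn i j))

    vᵢ = - (Σ₀ zero * α)
    v = insertAt w i vᵢ

    v-i : v i ≈ vᵢ
    v-i = reflexive (insertAt-lookup w i vᵢ)

    v-punchIn : ∀ j → v (punchIn i j) ≈ w j
    v-punchIn j = reflexive (insertAt-punchIn w i vᵢ j)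

    row : ∀ r → sum (λ j → v j * A r j) ≈ vᵢ * A r i + Σ₀ r
    row r = ≈-trans (sum-remove {i = i} (λ j → v j * A r j))
      (+-cong (*-congʳ v-i) (sum-cong-≋ (λ j → *-congʳ (v-punchIn j))))

    vA≈0 : ∀ r → sum (λ j → v j * A r j) ≈ 0#
    vA≈0 zero = begin
      sum (λ j → v j * A zero j)  ≈⟨ row zero ⟩
      vᵢ * A zero i + Σ₀ zero     ≈⟨ solve 3 (λ s α a → :- (s :* α) :* a :+ s := s :* (con (+ 1) :- a :* α))
                                       ≈-refl (Σ₀ zero) α (A zero i) ⟩
      Σ₀ zero * (_ - A zero i * α) ≈⟨ *-congˡ (+-cong ι-1 (-‿cong A₀ᵢα≈1)) ⟩
      Σ₀ zero * (1# - 1#)         ≈⟨ *-congˡ (-‿inverseʳ 1#) ⟩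
      Σ₀ zero * 0#                ≈⟨ zeroʳ _ ⟩
      0#                          ∎
    vA≈0 (suc r) = begin
      sum (λ j → v j * A (suc r) j)   ≈⟨ row (suc r) ⟩
      vᵢ * A (suc r) i + Σ₀ (suc r)   ≈⟨ solve 4 (λ s α a t → :- (s :* α) :* a :+ t := s :* (:- (α :* a)) :+ t)
                                           ≈-refl (Σ₀ zero) α (A (suc r) i) (Σ₀ (suc r)) ⟩
      Σ₀ zero * β + Σ₀ (suc r)        ≈⟨ +-congʳ (*-distribʳ-sum β (λ j → w j * A zero (punchIn i j))) ⟩
      sum (λ j → w j * A zero (punchIn i j) * β) + Σ₀ (suc r)
        ≈⟨ ∑-distrib-+ (λ j → w j * A zero (punchIn i j) * β) (λ j → w j * A (suc r) (punchIn i j)) ⟨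
      sum (λ j → w j * A zero (punchIn i j) * β + w j * A (suc r) (punchIn i j))
        ≈⟨ sum-cong-≋ (λ j → solve 4 (λ w a γ t → w :* a :* (:- γ) :+ w :* t := w :* (t :- a :* γ))
                               ≈-refl (w j) (A zero (punchIn i j)) (α * A (suc r) i) (A (suc r) (punchIn i j))) ⟩
      sum (λ j → w j * (A (suc r) (punchIn i j) - A zero (punchIn i j) * (α * A (suc r) i)))
        ≈⟨ wA≈0 r ⟩
      0# ∎
      where β = - (α * A (suc r) i)

  dot-sum : ∀ {n N} (a : Point R n) (w : Vector Carrier N) (q : Fin N → Point R n) →
            sum (λ j → a j * sum (λ i → w i * q i j)) ≈ sum (λ i → w i * dot R a (q i))
  dot-sum a w q = begin
    sum (λ j → a j * sum (λ i → w i * q i j))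
      ≈⟨ sum-cong-≋ (λ j → *-distribˡ-sum (a j) (λ i → w i * q i j)) ⟩
    sum (λ j → sum (λ i → a j * (w i * q i j)))
      ≈⟨ ∑-comm (λ j i → a j * (w i * q i j)) ⟩
    sum (λ i → sum (λ j → a j * (w i * q i j)))
      ≈⟨ sum-cong-≋ (λ i → sum-cong-≋ (λ j →
           solve 3 (λ a w q → a :* (w :* q) := w :* (a :* q)) ≈-refl (a j) (w i) (q i j))) ⟩
    sum (λ i → sum (λ j → w i * (a j * q i j)))
      ≈⟨ sum-cong-≋ (λ i → *-distribˡ-sum (w i) (λ j → a j * q i j)) ⟨
    sum (λ i → w i * dot R a (q i)) ∎

  dot-constant : ∀ {n N} (a : Point R n) (w : Vector Carrier N) (q : Fin N → Point R n) {b} →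
                 sum w ≈ 0# → (∀ i → dot R a (q i) ≈ b) →
                 sum (λ j → a j * sum (λ i → w i * q i j)) ≈ 0#
  dot-constant a w q {b} Σw≈0 aq≈b = begin
    sum (λ j → a j * sum (λ i → w i * q i j)) ≈⟨ dot-sum a w q ⟩
    sum (λ i → w i * dot R a (q i))           ≈⟨ sum-cong-≋ (λ i → *-congˡ (aq≈b i)) ⟩
    sum (λ i → w i * b)                       ≈⟨ *-distribʳ-sum b w ⟨
    sum w * b                                 ≈⟨ *-congʳ Σw≈0 ⟩
    0# * b                                    ≈⟨ zeroˡ b ⟩
    0#                                        ∎

  private
    cramer : ∀ {a b c d x y} → a * x + b * y ≈ 0# → c * x + d * y ≈ 0# →
             ¬ (a * d ≈ b * c) → x ≈ 0#
    cramer {a} {b} {c} {d} {x} {y} eq₁ eq₂ ad≉bc =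
      x*y≈0⇒y≈0 {a * d - b * c} (ad≉bc ∘ difference≈0) (begin
        (a * d - b * c) * x
          ≈⟨ solve 6 (λ a b c d x y → (a :* d :- b :* c) :* x :=
               d :* (a :* x :+ b :* y) :- b :* (c :* x :+ d :* y)) ≈-refl a b c d x y ⟩
        d * (a * x + b * y) - b * (c * x + d * y)
          ≈⟨ +-cong (≈-trans (*-congˡ eq₁) (zeroʳ d)) (-‿cong (≈-trans (*-congˡ eq₂) (zeroʳ b))) ⟩
        0# - 0# ≈⟨ -‿inverseʳ 0# ⟩
        0# ∎)
      where
      difference≈0 : ∀ {x y} → x - y ≈ 0# → x ≈ y
      difference≈0 {x} {y} x-y≈0 = begin
        x           ≈⟨ solve 2 (λ x y → x := x :- y :+ y) ≈-refl x y ⟩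
        x - y + y   ≈⟨ +-congʳ x-y≈0 ⟩
        0# + y      ≈⟨ +-identityˡ y ⟩
        y           ∎

  -- Let `E` be the combination of the points with weights `w`. Asking that `w` sum to zero and that
  -- `E` vanish outside `u` and `v` gives n - 1 homogeneous equations in at least n unknowns, so a
  -- nonzero `w` exists. The two given equations then form a 2-by-2 system for `E u` and `E v` with
  -- nonzero determinant.
  two-equations⇒dependent :
    ∀ {n N} (q : Fin N → Point R n) {a z : Point R n} {b d} {u v : Fin n} → n ℕ.≤ N →
    (∀ i → dot R a (q i) ≈ b) → (∀ i → dot R z (q i) ≈ d) →
    u ≢ v → ¬ (a u * z v ≈ a v * z u) → ¬ AffinelyIndependent R q
  two-equations⇒dependent {suc zero} q {u = zero} {v = zero} _ _ _ u≢v = contradiction ≡.refl u≢v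
  two-equations⇒dependent {suc (suc n)} {N} q {a} {z} {b} {d} {u} {v} n≤N aq≈b zq≈d u≢v det≉0 independent =
    proj₂ (proj₁ (proj₂ solution)) (independent w Σw≈0 E≈0 (proj₁ (proj₁ (proj₂ solution))))
    where
    v′ = punchOut u≢v
    rows : Fin (suc n) → Fin N → Carrier
    rows zero    i = 1#
    rows (suc r) i = q i (punchIn u (punchIn v′ r))
    solution = kernel (suc n) rows n≤N
    w = proj₁ solution
    E : Fin (suc (suc n)) → Carrier
    E j = sum (λ i → w i * q i j)

    Σw≈0 : sum w ≈ 0#
    Σw≈0 = ≈-trans (sum-cong-≋ (λ i → ≈-sym (*-identityʳ (w i)))) (proj₂ (proj₂ solution) zero)

    E-rest : ∀ j → j ≢ u → j ≢ v → E j ≈ 0#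
    E-rest j j≢u j≢v = ≡.subst (λ j → E j ≈ 0#) j≡ (proj₂ (proj₂ solution) (suc j″))
      where
      j′ = punchOut (j≢u ∘ ≡.sym)
      v′≢j′ : v′ ≢ j′
      v′≢j′ v′≡j′ = j≢v (≡.sym (≡.trans (≡.sym (punchIn-punchOut u≢v))
        (≡.trans (≡.cong (punchIn u) v′≡j′) (punchIn-punchOut _))))
      j″ = punchOut v′≢j′
      j≡ : punchIn u (punchIn v′ j″) ≡ j
      j≡ = ≡.trans (≡.cong (punchIn u) (punchIn-punchOut v′≢j′)) (punchIn-punchOut _)

    pair : ∀ (f : Point R _) {b} → (∀ i → dot R f (q i) ≈ b) → f u * E u + f v * E v ≈ 0#
    pair f fq≈b = ≈-trans
      (≈-sym (sum-pair u v u≢v (λ j j≢u j≢v → ≈-trans (*-congˡ (E-rest j j≢u j≢v)) (zeroʳ _))))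
      (dot-constant f w q Σw≈0 fq≈b)

    E≈0 : ∀ j → E j ≈ 0#
    E≈0 j with j ≟ u | j ≟ v
    ... | yes ≡.refl | _ = cramer (pair a aq≈b) (pair z zq≈d) det≉0
    ... | no _ | yes ≡.refl = cramer (≈-trans (+-comm _ _) (pair a aq≈b))
            (≈-trans (+-comm _ _) (pair z zq≈d)) (det≉0 ∘ ≈-sym)
    ... | no j≢u | no j≢v = E-rest j j≢u j≢v

-- The stable set polytope and its full-support facets.

module StableSetPolytope {c ℓ₁ ℓ₂} (R : RealField c ℓ₁ ℓ₂) {n} (G : Graph (Fin n)) where

  open RealField R hiding (zero)
  open FieldProperties R
  open LinearAlgebra R
  open Solver using (solve; _:+_; _:*_; _:-_; :-_; _:=_; con)
  open SetoidReasoning setoid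

  private
    χ : Subset n → Point R n
    χ = incidence R

  incidence-∈ : ∀ {n} {S : Subset n} {j} → j ∈ₛ S → incidence R S j ≈ 1#
  incidence-∈ j∈S rewrite []=⇒lookup j∈S = ≈-refl

  incidence-∉ : ∀ {n} {S : Subset n} {j} → j ∉ₛ S → incidence R S j ≈ 0#
  incidence-∉ {S = S} {j} j∉S with lookup S j in eq
  ... | true  = contradiction (lookup⇒[]= j S eq) j∉S
  ... | false = ≈-refl

  STAB-incidence : ∀ {S} → Stable G S → STAB R G (incidence R S)
  STAB-incidence {S} stable =
    1 , (λ _ → incidence R S) , (λ _ → 1#) , (λ _ → S , stable , λ _ → ≈-refl) ,
    (λ _ → 0≤1) , +-identityʳ 1# , λ _ → ≈-sym (≈-trans (+-identityʳ _) (*-identityˡ _))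

  stable-∅ : Stable G ∅
  stable-∅ u v u∈∅ = contradiction u∈∅ ∉⊥

  stable-⁅⁆ : ∀ w → Stable G ⁅ w ⁆
  stable-⁅⁆ w u v u∈ v∈ uv with x∈⁅y⁆⇒x≡y w u∈ | x∈⁅y⁆⇒x≡y w v∈
  ... | ≡.refl | ≡.refl = Graph.~-irrefl G uv

  dot-support : ∀ a {S} w → w ∈ₛ S → (∀ j → j ∈ₛ S → j ≡ w) → dot R a (χ S) ≈ a w
  dot-support a w w∈S only = ≈-trans
    (sum-single w (λ j j≢w → ≈-trans (*-congˡ (incidence-∉ (j≢w ∘ only j))) (zeroʳ (a j))))
    (≈-trans (*-congˡ (incidence-∈ w∈S)) (*-identityʳ (a w)))

  dot-pair : ∀ a {S} u w → u ≢ w → u ∈ₛ S → w ∈ₛ S → (∀ j → j ∈ₛ S → j ≢ u → j ≡ w) →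
             dot R a (χ S) ≈ a u + a w
  dot-pair a u w u≢w u∈S w∈S only = ≈-trans
    (sum-pair u w u≢w (λ j j≢u j≢w →
      ≈-trans (*-congˡ (incidence-∉ (λ j∈S → j≢w (only j j∈S j≢u)))) (zeroʳ (a j))))
    (+-cong (≈-trans (*-congˡ (incidence-∈ u∈S)) (*-identityʳ (a u)))
            (≈-trans (*-congˡ (incidence-∈ w∈S)) (*-identityʳ (a w))))

  dot-remove : ∀ a {S} i → i ∈ₛ S → dot R a (χ S) ≈ a i + dot R a (χ (S ∩ ∁ ⁅ i ⁆))
  dot-remove a {S} i i∈S = begin
    dot R a (χ S)                             ≈⟨ sum-cong-≋ split ⟩
    sum (λ j → a j * χ ⁅ i ⁆ j + a j * χ (S ∩ ∁ ⁅ i ⁆) j)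
                                              ≈⟨ ∑-distrib-+ (λ j → a j * χ ⁅ i ⁆ j) (λ j → a j * χ (S ∩ ∁ ⁅ i ⁆) j) ⟩
    dot R a (χ ⁅ i ⁆) + dot R a (χ (S ∩ ∁ ⁅ i ⁆)) ≈⟨ +-congʳ (dot-support a i (x∈⁅x⁆ i) (λ j → x∈⁅y⁆⇒x≡y i)) ⟩
    a i + dot R a (χ (S ∩ ∁ ⁅ i ⁆))           ∎
    where
    χ-split : ∀ j → χ S j ≈ χ ⁅ i ⁆ j + χ (S ∩ ∁ ⁅ i ⁆) j
    χ-split j with j ≟ i | j ∈? S
    ... | yes ≡.refl | _ = ≈-sym (≈-trans
            (+-cong (incidence-∈ (x∈⁅x⁆ i))
                    (incidence-∉ (λ i∈ → x∈∁p⇒x∉p (proj₂ (x∈p∩q⁻ S _ i∈)) (x∈⁅x⁆ i))))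
            (≈-trans (+-identityʳ 1#) (≈-sym (incidence-∈ i∈S))))
    ... | no j≢i | yes j∈S = ≈-sym (≈-trans
            (+-cong (incidence-∉ (j≢i ∘ x∈⁅y⁆⇒x≡y i))
                    (incidence-∈ (x∈p∩q⁺ (j∈S , x∉p⇒x∈∁p (j≢i ∘ x∈⁅y⁆⇒x≡y i)))))
            (≈-trans (+-identityˡ 1#) (≈-sym (incidence-∈ j∈S))))
    ... | no j≢i | no j∉S = ≈-sym (≈-trans
            (+-cong (incidence-∉ (j≢i ∘ x∈⁅y⁆⇒x≡y i))
                    (incidence-∉ (λ j∈ → j∉S (proj₁ (x∈p∩q⁻ S _ j∈)))))
            (≈-trans (+-identityˡ 0#) (≈-sym (incidence-∉ j∉S))))

    split : ∀ j → a j * χ S j ≈ a j * χ ⁅ i ⁆ j + a j * χ (S ∩ ∁ ⁅ i ⁆) j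
    split j = ≈-trans (*-congˡ (χ-split j)) (distribˡ _ _ _)

  -- The origin and the unit vectors lie in the polytope and are affinely independent; if d < n,
  -- then d + 1 unit vectors are available, which is one point too many.
  dim≥n : ∀ {d} → HasDimension R (STAB R G) d → n ℕ.≤ d
  dim≥n {d} (_ , bounded) = ℕ.≮⇒≥ λ d<n → bounded (points d<n) (inSTAB d<n) (independent d<n)
    where
    points : d ℕ.< n → Fin (2 ℕ.+ d) → Point R n
    points d<n zero    = χ ∅
    points d<n (suc i) = χ ⁅ inject≤ i d<n ⁆

    inSTAB : ∀ d<n i → STAB R G (points d<n i)
    inSTAB d<n zero    = STAB-incidence stable-∅
    inSTAB d<n (suc i) = STAB-incidence (stable-⁅⁆ (inject≤ i d<n))

    independent : ∀ d<n → AffinelyIndependent R (points d<n)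
    independent d<n w Σw≈0 wp≈0 = λ where
        zero → ≈-trans (≈-sym (+-identityʳ _)) (≈-trans (+-congˡ (≈-sym (sum-zero tail≈0))) Σw≈0)
        (suc i) → tail≈0 i
      where
      tail≈0 : ∀ i → w (suc i) ≈ 0#
      tail≈0 i = begin
        w (suc i)                     ≈⟨ *-identityʳ _ ⟨
        w (suc i) * 1#                ≈⟨ *-congˡ (incidence-∈ (x∈⁅x⁆ e)) ⟨
        w (suc i) * χ ⁅ e ⁆ e         ≈⟨ sum-single {f = λ k → w k * points d<n k e} (suc i) others ⟨
        sum (λ k → w k * points d<n k e) ≈⟨ wp≈0 e ⟩
        0# ∎
        where
        e = inject≤ i d<n
        others : ∀ k → k ≢ suc i → w k * points d<n k e ≈ 0#
        others zero _ = ≈-trans (*-congˡ (incidence-∉ (∉⊥ {x = e}))) (zeroʳ _)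
        others (suc k) k≢i = ≈-trans (*-congˡ (incidence-∉ (λ e∈ → k≢i (≡.cong suc
          (≡.sym (inject≤-injective d<n d<n i k (x∈⁅y⁆⇒x≡y _ e∈))))))) (zeroʳ _)

  module Facet {a : Point R n} {b} (facet : IsFacet R (STAB R G) a b)
               (support : ∀ i → ¬ (a i ≈ 0#)) (n>1 : 1 ℕ.< n) where

    valid : ∀ {S} → Stable G S → dot R a (χ S) ≤ b
    valid stable = proj₁ facet _ (STAB-incidence stable)

    -- In a convex combination on the face the weighted slacks are nonnegative and add up to zero,
    -- so only tight stable sets carry nonzero weight.
    face-equation : ∀ (z : Point R n) →
      (∀ S → Stable G S → dot R a (χ S) ≈ b → dot R z (χ S) ≈ 0#) →
      ∀ x → STAB R G x → dot R a x ≈ b → dot R z x ≈ 0#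
    face-equation z zS≈0 x (k , p , w , p∈ , 0≤w , Σw≈1 , x≈) ax≈b = begin
      sum (λ j → z j * x j)                     ≈⟨ sum-cong-≋ (λ j → *-congˡ (x≈ j)) ⟩
      sum (λ j → z j * sum (λ i → w i * p i j)) ≈⟨ dot-sum z w p ⟩
      sum (λ i → w i * dot R z (p i))           ≈⟨ sum-zero term≈0 ⟩
      0#                                        ∎
      where
      S : Fin k → Subset n
      S i = proj₁ (p∈ i)

      dot-p : ∀ f i → dot R f (p i) ≈ dot R f (χ (S i))
      dot-p f i = sum-cong-≋ (λ j → *-congˡ (proj₂ (proj₂ (p∈ i)) j))

      slack : ∀ i → 0# ≤ b - dot R a (p i)
      slack i = ≤⇒0≤- (≤-resp-≈ (≈-sym (dot-p a i)) ≈-refl (valid (proj₁ (proj₂ (p∈ i)))))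

      Σslack≈0 : sum (λ i → w i * (b - dot R a (p i))) ≈ 0#
      Σslack≈0 = begin
        sum (λ i → w i * (b - dot R a (p i)))
          ≈⟨ sum-cong-≋ (λ i → solve 3 (λ w b d → w :* (b :- d) := w :* b :+ con -[1+ 0 ] :* (w :* d))
                                ≈-refl (w i) b (dot R a (p i))) ⟩
        sum (λ i → w i * b + ιℤ -[1+ 0 ] * (w i * dot R a (p i)))
          ≈⟨ ∑-distrib-+ (λ i → w i * b) (λ i → ιℤ -[1+ 0 ] * (w i * dot R a (p i))) ⟩
        sum (λ i → w i * b) + sum (λ i → ιℤ -[1+ 0 ] * (w i * dot R a (p i)))
          ≈⟨ +-cong (*-distribʳ-sum b w) (*-distribˡ-sum (ιℤ -[1+ 0 ]) (λ i → w i * dot R a (p i))) ⟨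
        sum w * b + ιℤ -[1+ 0 ] * sum (λ i → w i * dot R a (p i))
          ≈⟨ +-cong (≈-sym (≈-trans (*-congʳ Σw≈1) (*-identityˡ b))) (*-congˡ (dot-sum a w p)) ⟨
        b + ιℤ -[1+ 0 ] * sum (λ j → a j * sum (λ i → w i * p i j))
          ≈⟨ +-congˡ (*-congˡ (sum-cong-≋ (λ j → *-congˡ (x≈ j)))) ⟨
        b + ιℤ -[1+ 0 ] * dot R a x ≈⟨ +-congˡ (*-congˡ ax≈b) ⟩
        b + ιℤ -[1+ 0 ] * b ≈⟨ solve 1 (λ b → b :+ con -[1+ 0 ] :* b := con (+ 0)) ≈-refl b ⟩
        0# ∎

      term≈0 : ∀ i → w i * dot R z (p i) ≈ 0#
      term≈0 i with w i ≈? 0#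
      ... | yes wᵢ≈0 = ≈-trans (*-congʳ wᵢ≈0) (zeroˡ _)
      ... | no wᵢ≉0 = ≈-trans (*-congˡ (≈-trans (dot-p z i) (zS≈0 (S i) (proj₁ (proj₂ (p∈ i))) tight))) (zeroʳ _)
        where
        tight : dot R a (χ (S i)) ≈ b
        tight = begin
          dot R a (χ (S i))                    ≈⟨ dot-p a i ⟨
          dot R a (p i)                        ≈⟨ +-identityˡ _ ⟨
          0# + dot R a (p i)                   ≈⟨ +-congʳ (x*y≈0⇒y≈0 wᵢ≉0
                                                    (sum-nonNeg-≈0 (λ i → *-nonNeg (0≤w i) (slack i)) Σslack≈0 i)) ⟨
          b - dot R a (p i) + dot R a (p i)    ≈⟨ solve 2 (λ b d → b :- d :+ d := b) ≈-refl b (dot R a (p i)) ⟩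
          b                                    ∎

    -- The facet contains at least n affinely independent points, so z·x = 0 cannot be independent
    -- of a·x = b: every 2-by-2 minor of the rows a and z vanishes.
    face-rank : ∀ (z : Point R n) →
      (∀ S → Stable G S → dot R a (χ S) ≈ b → dot R z (χ S) ≈ 0#) →
      ∀ {u v} → u ≢ v → a u * z v ≈ a v * z u
    face-rank z zS≈0 {u} {v} u≢v with proj₂ facet
    ... | d , dimP , ((q , q∈ , independent) , _) = decidable-stable (a u * z v ≈? a v * z u) λ det≉0 →
      two-equations⇒dependent q (dim≥n dimP) (proj₂ ∘ q∈)
        (λ i → face-equation z zS≈0 (q i) (proj₁ (q∈ i)) (proj₂ (q∈ i))) u≢v det≉0 independent

    -- If `a i` were negative, no tight stable set would contain `i`, since dropping `i` would
    -- exceed `b`. The indicator of `i` would then vanish on all tight sets, and `face-rank` would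
    -- make the coefficient of a second vertex zero.
    coefficient-positive : ∀ i → ¬ (a i ≤ 0#)
    coefficient-positive i aᵢ≤0 = support v (begin
      a v             ≈⟨ *-identityʳ (a v) ⟨
      a v * 1#        ≈⟨ *-congˡ (incidence-∈ (x∈⁅x⁆ i)) ⟨
      a v * χ ⁅ i ⁆ i ≈⟨ face-rank (χ ⁅ i ⁆) outside-tight i≢v ⟨
      a i * χ ⁅ i ⁆ v ≈⟨ *-congˡ (incidence-∉ (i≢v ∘ ≡.sym ∘ x∈⁅y⁆⇒x≡y i)) ⟩
      a i * 0#        ≈⟨ zeroʳ (a i) ⟩
      0#              ∎)
      where
      other : ∀ {m} → 1 ℕ.< m → (i : Fin m) → ∃[ j ] i ≢ j
      other (ℕ.s≤s (ℕ.s≤s _)) zero    = suc zero , λ ()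
      other (ℕ.s≤s (ℕ.s≤s _)) (suc i) = zero , λ ()
      v = proj₁ (other n>1 i)
      i≢v = proj₂ (other n>1 i)

      outside-tight : ∀ S → Stable G S → dot R a (χ S) ≈ b → dot R (χ ⁅ i ⁆) (χ S) ≈ 0#
      outside-tight S stable tight with i ∈? S
      ... | yes i∈S = contradiction (≤-antisym aᵢ≤0 0≤aᵢ) (support i)
        where
        S′ = S ∩ ∁ ⁅ i ⁆
        S′-stable : Stable G S′
        S′-stable u v u∈ v∈ = stable u v (proj₁ (x∈p∩q⁻ S _ u∈)) (proj₁ (x∈p∩q⁻ S _ v∈))
        0≤aᵢ : 0# ≤ a i
        0≤aᵢ = +-cancelʳ-≤ (dot R a (χ S′)) (≤-resp-≈ (≈-sym (+-identityˡ _))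
                 (≈-trans (≈-sym tight) (dot-remove a i i∈S)) (valid S′-stable))
      ... | no i∉S = sum-zero χχ≈0
        where
        χχ≈0 : ∀ j → χ ⁅ i ⁆ j * χ S j ≈ 0#
        χχ≈0 j with j ≟ i
        ... | yes ≡.refl = ≈-trans (*-congˡ (incidence-∉ i∉S)) (zeroʳ _)
        ... | no j≢i = ≈-trans (*-congʳ (incidence-∉ (j≢i ∘ x∈⁅y⁆⇒x≡y i))) (zeroˡ _)

    -- Such a z vanishes on every tight stable set, since these are edges or isolated
    -- vertices of the complement.
    alternating⇒0 :
      (∀ {u v w} → Adj (complement G) u v → Adj (complement G) v w → ¬ Adj (complement G) u w) →
      (z : Point R n) → (∀ {u w} → Adj (complement G) u w → z u + z w ≈ 0#) →
      (∀ u → (∀ w → ¬ Adj (complement G) u w) → z u ≈ 0#) → ∀ u → z u ≈ 0#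
    alternating⇒0 triangle-free z alternating isolated u with z u ≈? 0#
    ... | yes zᵤ≈0 = zᵤ≈0
    ... | no zᵤ≉0 with any? (λ w → Graph.~-dec (complement G) u w)
    ...   | no none = isolated u (λ w uw → none (w , uw))
    -- The product splits into the alternating condition at uw and a minor that vanishes by
    -- `face-rank`; positivity of a keeps the factor `a u + a w` away from zero.
    ...   | yes (w , uw) = contradiction (x*y≈0⇒y≈0 aᵤ+aw≉0 (begin
        (a u + a w) * z u              ≈⟨ solve 4 (λ a b z y → (a :+ b) :* z := a :* (z :+ y) :- (a :* y :- b :* z))
                                            ≈-refl (a u) (a w) (z u) (z w) ⟩
        a u * (z u + z w) - (a u * z w - a w * z u)
          ≈⟨ +-cong (≈-trans (*-congˡ (alternating uw)) (zeroʳ (a u)))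
                    (-‿cong (≈-trans (+-congʳ (face-rank z on-tight (proj₁ uw))) (-‿inverseʳ _))) ⟩
        0# - 0#                        ≈⟨ -‿inverseʳ 0# ⟩
        0#                             ∎)) zᵤ≉0
      where
      0≤a : ∀ i → 0# ≤ a i
      0≤a i with total 0# (a i)
      ... | inj₁ 0≤aᵢ = 0≤aᵢ
      ... | inj₂ aᵢ≤0 = contradiction aᵢ≤0 (coefficient-positive i)

      aᵤ+aw≉0 : ¬ (a u + a w ≈ 0#)
      aᵤ+aw≉0 = support u ∘ x+y≈0,0≤⇒x≈0 (0≤a u) (0≤a w)

      on-tight : ∀ S → Stable G S → dot R a (χ S) ≈ b → dot R z (χ S) ≈ 0#
      on-tight S stable tight with any? (_∈? S)
      ... | no empty = sum-zero (λ j → ≈-trans (*-congˡ (incidence-∉ (λ j∈S → empty (j , j∈S)))) (zeroʳ _))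
      ... | yes (p , p∈S) with any? (λ q → (q ∈? S) ×-dec ¬? (q ≟ p))
      ...   | yes (q , q∈S , q≢p) = ≈-trans
                (dot-pair z p q (q≢p ∘ ≡.sym) p∈S q∈S only)
                (alternating (q≢p ∘ ≡.sym , stable p q p∈S q∈S))
        where
        only : ∀ j → j ∈ₛ S → j ≢ p → j ≡ q
        only j j∈S j≢p = decidable-stable (j ≟ q) λ j≢q → triangle-free
          (j≢p , stable j p j∈S p∈S) (q≢p ∘ ≡.sym , stable p q p∈S q∈S) (j≢q , stable j q j∈S q∈S)
      ...   | no alone = ≈-trans (dot-support z p p∈S only) (isolated p not-edge)
        where
        only : ∀ j → j ∈ₛ S → j ≡ p
        only j j∈S = decidable-stable (j ≟ p) λ j≢p → alone (j , j∈S , j≢p)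

        -- If {p} is tight and q is an H-neighbour of p, the stable pair {p, q} has value above `b`,
        -- because `a q` is positive.
        not-edge : ∀ q → ¬ Adj (complement G) p q
        not-edge q (p≢q , ¬pq) = coefficient-positive q (+-cancelʳ-≤ (a p) (≤-resp-≈
            (≈-trans
              (dot-pair a p q p≢q (x∈p∪q⁺ (inj₁ (x∈⁅x⁆ p))) (x∈p∪q⁺ (inj₂ (x∈⁅x⁆ q))) in-pair)
              (+-comm _ _))
            (≈-trans (≈-sym tight) (≈-trans (dot-support a p p∈S only) (≈-sym (+-identityˡ _))))
            (valid pair-stable)))
          where
          pair = ⁅ p ⁆ ∪ ⁅ q ⁆
          cases : ∀ j → j ∈ₛ pair → j ≡ p ⊎ j ≡ q
          cases j j∈ with x∈p∪q⁻ ⁅ p ⁆ ⁅ q ⁆ j∈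
          ... | inj₁ j∈p = inj₁ (x∈⁅y⁆⇒x≡y p j∈p)
          ... | inj₂ j∈q = inj₂ (x∈⁅y⁆⇒x≡y q j∈q)
          in-pair : ∀ j → j ∈ₛ pair → j ≢ p → j ≡ q
          in-pair j j∈ j≢p with cases j j∈
          ... | inj₁ j≡p = contradiction j≡p j≢p
          ... | inj₂ j≡q = j≡q
          pair-stable : Stable G pair
          pair-stable u v u∈ v∈ uv with cases u u∈ | cases v v∈
          ... | inj₁ ≡.refl | inj₁ ≡.refl = Graph.~-irrefl G uv
          ... | inj₁ ≡.refl | inj₂ ≡.refl = ¬pq uv
          ... | inj₂ ≡.refl | inj₁ ≡.refl = ¬pq (Graph.~-sym G uv)
          ... | inj₂ ≡.refl | inj₂ ≡.refl = Graph.~-irrefl G uv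

-- Cyclic indices and counting with indicators.

module ΣN = SemiringSum ℕ.+-*-semiring

-- Cyclic predecessor without modular arithmetic: the edges from `suc i` to `inject₁ i` form a path,
-- and index `zero` contributes the closing edge.
cpred : ∀ {m} → Fin (suc m) → Fin (suc m)
cpred {m} zero = fromℕ m
cpred (suc i)  = inject₁ i

cpred-injective : ∀ {m} → Injective _≡_ _≡_ (cpred {m})
cpred-injective {_} {zero}  {zero}  _  = ≡.refl
cpred-injective {_} {zero}  {suc j} eq = contradiction eq fromℕ≢inject₁
cpred-injective {_} {suc i} {zero}  eq = contradiction (≡.sym eq) fromℕ≢inject₁
cpred-injective {_} {suc i} {suc j} eq = ≡.cong suc (inject₁-injective eq)

module _ {n : ℕ} where

  δ : Fin n → Fin n → ℕ
  δ u v = if does (u ≟ v) then 1 else 0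

  δ-≡ : ∀ {u v} → u ≡ v → δ u v ≡ 1
  δ-≡ {u} {v} u≡v rewrite dec-true (u ≟ v) u≡v = ≡.refl

  δ-≢ : ∀ {u v} → u ≢ v → δ u v ≡ 0
  δ-≢ {u} {v} u≢v rewrite dec-false (u ≟ v) u≢v = ≡.refl

sumℕ-zero : ∀ {m} {f : Fin m → ℕ} → (∀ k → f k ≡ 0) → ΣN.sum f ≡ 0
sumℕ-zero {zero}  f≡0 = ≡.refl
sumℕ-zero {suc m} f≡0 = ≡.cong₂ ℕ._+_ (f≡0 zero) (sumℕ-zero (f≡0 ∘ suc))

sumℕ-mono : ∀ {m} {f g : Fin m → ℕ} → (∀ k → f k ℕ.≤ g k) → ΣN.sum f ℕ.≤ ΣN.sum g
sumℕ-mono {zero}  f≤g = z≤n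
sumℕ-mono {suc m} f≤g = ℕ.+-mono-≤ (f≤g zero) (sumℕ-mono (f≤g ∘ suc))

sumℕ-strict : ∀ {m} {f g : Fin m → ℕ} → (∀ k → f k ℕ.≤ g k) → ∀ k → f k ℕ.< g k →
              ΣN.sum f ℕ.< ΣN.sum g
sumℕ-strict f≤g zero    f<g = ℕ.+-mono-<-≤ f<g (sumℕ-mono (f≤g ∘ suc))
sumℕ-strict f≤g (suc k) f<g = ℕ.+-mono-≤-< (f≤g zero) (sumℕ-strict (f≤g ∘ suc) k f<g)

sumℕ-one : ∀ m → ΣN.sum {m} (λ _ → 1) ≡ m
sumℕ-one zero    = ≡.refl
sumℕ-one (suc m) = ≡.cong suc (sumℕ-one m)

sumℕ-δ : ∀ {n} (u : Fin n) → ΣN.sum (δ u) ≡ 1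
sumℕ-δ {suc n} zero = ≡.cong suc (sumℕ-zero {n} {f = λ v → δ zero (suc v)} (λ _ → ≡.refl))
sumℕ-δ {suc n} (suc u) = ≡.trans
  (≡.cong₂ ℕ._+_ (δ-≢ {u = suc u} {v = zero} λ ()) (ΣN.sum-cong-≋ shift)) (sumℕ-δ u)
  where
  shift : ∀ v → δ (suc u) (suc v) ≡ δ u v
  shift v with u ≟ v
  ... | yes u≡v = ≡.refl
  ... | no u≢v = ≡.refl

sumℕ-injective≤1 : ∀ {m n} {c : Fin m → Fin n} → Injective _≡_ _≡_ c → ∀ v →
                   ΣN.sum (λ k → δ (c k) v) ℕ.≤ 1
sumℕ-injective≤1 {zero} inj v = z≤n
sumℕ-injective≤1 {suc m} {c = c} inj v with c zero ≟ v
... | yes c₀≡v = ℕ.≤-reflexive (≡.cong suc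
        (sumℕ-zero {f = λ k → δ (c (suc k)) v}
          (λ k → δ-≢ λ cₖ≡v → 0≢suc k (inj (≡.trans c₀≡v (≡.sym cₖ≡v))))))
  where
  0≢suc : ∀ k → zero ≢ suc k
  0≢suc k ()
... | no  _ = sumℕ-injective≤1 (suc-injective ∘ inj) v

-- Quadratic forms and the odd-cycle inequality.

module QuadraticForm {c ℓ₁ ℓ₂} (R : RealField c ℓ₁ ℓ₂) where

  open RealField R hiding (zero)
  open FieldProperties R
  open Solver using (solve; _:+_; _:*_; _:-_; :-_; _:=_; con)
  open ≤-Reasoning

  ι-sum : ∀ {m} (f : Fin m → ℕ) → ι (ΣN.sum f) ≈ sum (ι ∘ f)
  ι-sum {zero}  f = ≈-refl
  ι-sum {suc m} f = ≈-trans (ι-+ (f zero) _) (+-congˡ (ι-sum (f ∘ suc)))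

  Q : ∀ {n} → Point R n → Matrix R n → Carrier
  Q z A = sum (λ i → sum (λ j → z i * A i j * z j))

  module _ {n} (z : Point R n) where

    Q-cong : ∀ {A B} → (∀ i j → A i j ≈ B i j) → Q z A ≈ Q z B
    Q-cong A≈B = sum-cong-≋ (λ i → sum-cong-≋ (λ j → *-congʳ (*-congˡ (A≈B i j))))

    Q-+ : ∀ A B → Q z (λ i j → A i j + B i j) ≈ Q z A + Q z B
    Q-+ A B = ≈-trans
      (sum-cong-≋ (λ i → ≈-trans
        (sum-cong-≋ (λ j → solve 4 (λ z a b y → z :* (a :+ b) :* y := z :* a :* y :+ z :* b :* y)
                             ≈-refl (z i) (A i j) (B i j) (z j)))
        (∑-distrib-+ (λ j → z i * A i j * z j) (λ j → z i * B i j * z j))))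
      (∑-distrib-+ (λ i → sum (λ j → z i * A i j * z j)) (λ i → sum (λ j → z i * B i j * z j)))

    Q-scale : ∀ s A → Q z (λ i j → s * A i j) ≈ s * Q z A
    Q-scale s A = ≈-trans
      (sum-cong-≋ (λ i → ≈-trans
        (sum-cong-≋ (λ j → solve 4 (λ z s a y → z :* (s :* a) :* y := s :* (z :* a :* y))
                             ≈-refl (z i) s (A i j) (z j)))
        (≈-sym (*-distribˡ-sum s (λ j → z i * A i j * z j)))))
      (≈-sym (*-distribˡ-sum s (λ i → sum (λ j → z i * A i j * z j))))

    Q-outer : ∀ f → Q z (λ i j → f i * f j) ≈ dot R z f * dot R z f
    Q-outer f = ≈-trans
      (sum-cong-≋ (λ i → ≈-trans
        (sum-cong-≋ (λ j → solve 4 (λ z f g y → z :* (f :* g) :* y := z :* f :* (y :* g))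
                             ≈-refl (z i) (f i) (f j) (z j)))
        (≈-sym (*-distribˡ-sum (z i * f i) (λ j → z j * f j)))))
      (≈-sym (*-distribʳ-sum (dot R z f) (λ i → z i * f i)))

    Q-sum : ∀ {m} (A : Fin m → Matrix R n) →
            Q z (λ i j → sum (λ k → A k i j)) ≈ sum (λ k → Q z (A k))
    Q-sum {zero} A = sum-zero (λ i → sum-zero (λ j → ≈-trans (*-congʳ (zeroʳ (z i))) (zeroˡ (z j))))
    Q-sum {suc m} A = ≈-trans (Q-+ (A zero) (λ i j → sum (λ k → A (suc k) i j)))
                              (+-congˡ (Q-sum (A ∘ suc)))

  sgn : ℕ → Carrier
  sgn zero    = 1#
  sgn (suc m) = - sgn m

  sgn-double : ∀ k → sgn (2 ℕ.* k) ≈ 1#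
  sgn-double zero = ≈-refl
  sgn-double (suc k) = ≈-trans (reflexive (≡.cong sgn (ℕ.*-suc 2 k)))
    (≈-trans (solve 1 (λ s → :- :- s := s) ≈-refl _) (sgn-double k))

  square-bound : ∀ x y → (x - y) * (x - y) ≤ ι 2 * (x * x) + ι 2 * (y * y)
  square-bound x y = 0≤-⇒≤ (≤-resp-≈ ≈-refl
    (solve 2 (λ x y → (x :+ y) :* (x :+ y) :=
      con (+ 2) :* (x :* x) :+ con (+ 2) :* (y :* y) :- (x :- y) :* (x :- y)) ≈-refl x y)
    (0≤x*x (x + y)))

  -- Each further edge doubles the constant. Cauchy-Schwarz would give a linear one, but s may be as
  -- large as needed, so the cheaper induction suffices.
  double-bound : ∀ k {x d s} → d * d ≤ ι (2 ℕ.^ k) * s →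
                 (x - d) * (x - d) ≤ ι (2 ℕ.^ suc k) * (x * x + s)
  double-bound k {x} {d} {s} d²≤ = begin
    (x - d) * (x - d)                            ≤⟨ square-bound x d ⟩
    ι 2 * (x * x) + ι 2 * (d * d)                ≤⟨ +-mono-≤ (*-monoˡ-≤ (0≤ι 2) x²≤) (*-monoˡ-≤ (0≤ι 2) d²≤) ⟩
    ι 2 * (ι (2 ℕ.^ k) * (x * x)) + ι 2 * (ι (2 ℕ.^ k) * s)
      ≈⟨ solve 4 (λ a b x s → a :* (b :* x) :+ a :* (b :* s) := a :* b :* (x :+ s))
           ≈-refl (ι 2) (ι (2 ℕ.^ k)) (x * x) s ⟩
    ι 2 * ι (2 ℕ.^ k) * (x * x + s)              ≈⟨ *-congʳ (ι-* 2 (2 ℕ.^ k)) ⟨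
    ι (2 ℕ.^ suc k) * (x * x + s)                ∎
    where
    x²≤ : x * x ≤ ι (2 ℕ.^ k) * (x * x)
    x²≤ = begin
      x * x                    ≈⟨ *-identityʳ _ ⟨
      x * x * 1#               ≈⟨ *-congˡ ι-1 ⟨
      x * x * ι 1              ≤⟨ *-monoˡ-≤ (0≤x*x x) (ι-mono (ℕ.m^n>0 2 k)) ⟩
      x * x * ι (2 ℕ.^ k)      ≈⟨ *-comm _ _ ⟩
      ι (2 ℕ.^ k) * (x * x)    ∎

  -- The difference `d` is the alternating sum of the edge sums along the path: it equals the first
  -- edge sum minus the difference for the path that starts one vertex later.
  path-bound : ∀ m (x : Vector Carrier (suc m)) → let d = x zero - sgn m * x (fromℕ m) in
    d * d ≤ ι (2 ℕ.^ m) * sum (λ i → (x (suc i) + x (inject₁ i)) * (x (suc i) + x (inject₁ i)))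
  path-bound zero x = ≤-reflexive (≈-trans
    (≈-trans (*-congʳ x-x≈0) (zeroˡ _)) (≈-sym (zeroʳ _)))
    where
    x-x≈0 : x zero - 1# * x zero ≈ 0#
    x-x≈0 = ≈-trans (+-congˡ (-‿cong (*-identityˡ _))) (-‿inverseʳ _)
  path-bound (suc m) x = ≤-resp-≈ (*-cong eq eq) ≈-refl
    (double-bound m (path-bound m (x ∘ suc)))
    where
    eq : x (suc zero) + x zero - (x (suc zero) - sgn m * x (suc (fromℕ m)))
         ≈ x zero - (- sgn m) * x (suc (fromℕ m))
    eq = solve 4 (λ x₁ x₀ s l → x₁ :+ x₀ :- (x₁ :- s :* l) := x₀ :- (:- s) :* l)
           ≈-refl (x (suc zero)) (x zero) (sgn m) (x (suc (fromℕ m)))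

  -- On an odd cycle 2 x₀ is the alternating sum of the edge sums starting at 0.
  odd-cycle-bound : ∀ {m} (x : Vector Carrier (suc m)) → sgn m ≈ 1# →
    (ι 2 * x zero) * (ι 2 * x zero) ≤
      ι (2 ℕ.^ suc m) * sum (λ i → (x i + x (cpred i)) * (x i + x (cpred i)))
  odd-cycle-bound {m} x sgn≈1 = ≤-resp-≈ (*-cong eq eq) ≈-refl
    (double-bound m (≤-resp-≈ neg² ≈-refl (path-bound m x)))
    where
    s = sgn m
    l = x (fromℕ m)
    neg² : (x zero - s * l) * (x zero - s * l) ≈ (s * l - x zero) * (s * l - x zero)
    neg² = solve 2 (λ x y → (x :- y) :* (x :- y) := (y :- x) :* (y :- x)) ≈-refl (x zero) (s * l)
    eq : x zero + l - (s * l - x zero) ≈ ι 2 * x zero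
    eq = ≈-trans (+-congˡ (-‿cong (+-congʳ (≈-trans (*-congʳ sgn≈1) (*-identityˡ l)))))
      (solve 2 (λ x l → x :+ l :- (l :- x) := con (+ 2) :* x) ≈-refl (x zero) l)

-- The certificate matrix for a cycle with a further neighbour, in natural numbers.

module PendantCycle where

  open import Data.Nat.Base using (_+_; _*_; _≤_; _<_)

  module _ {n} (G : Graph (Fin n)) {x y : Fin n} (xy : Adj (complement G) x y) where

    edge≤1 : ∀ u → δ x u + δ y u ≤ 1
    edge≤1 u with x ≟ u
    ... | yes x≡u = ℕ.≤-reflexive (≡.cong suc (δ-≢ λ y≡u → proj₁ xy (≡.trans x≡u (≡.sym y≡u))))
    ... | no _ with y ≟ u
    ...   | yes _ = s≤s z≤n
    ...   | no  _ = z≤n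

    edge-support : ∀ u → δ x u + δ y u ≡ 0 ⊎ (x ≡ u ⊎ y ≡ u)
    edge-support u with x ≟ u | y ≟ u
    ... | yes x≡u | _       = inj₂ (inj₁ x≡u)
    ... | no _    | yes y≡u = inj₂ (inj₂ y≡u)
    ... | no _    | no _    = inj₁ refl

    edge-adjacent≤1 : ∀ {u w} → Adj G u w → δ x u + δ y u + (δ x w + δ y w) ≤ 1
    edge-adjacent≤1 {u} {w} uw with edge-support u | edge-support w
    ... | inj₁ ≡0 | _ rewrite ≡0 = edge≤1 w
    ... | _ | inj₁ ≡0 rewrite ≡0 = ≡.subst (_≤ 1) (≡.sym (ℕ.+-identityʳ _)) (edge≤1 u)
    ... | inj₂ (inj₁ refl) | inj₂ (inj₁ refl) = contradiction uw (Graph.~-irrefl G)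
    ... | inj₂ (inj₁ refl) | inj₂ (inj₂ refl) = contradiction uw (proj₂ xy)
    ... | inj₂ (inj₂ refl) | inj₂ (inj₁ refl) = contradiction (Graph.~-sym G uw) (proj₂ xy)
    ... | inj₂ (inj₂ refl) | inj₂ (inj₂ refl) = contradiction uw (Graph.~-irrefl G)

  module CycleWithPendant {n} (G : Graph (Fin n)) {m′} (m′≥4 : 4 ≤ m′)
    {c : Fin (suc m′) → Fin n} (c-injective : Injective _≡_ _≡_ c)
    (c-adj : ∀ a → Adj (complement G) (c a) (c (cpred a)))
    {v} (c≢v : ∀ a → c a ≢ v) (vt : Adj (complement G) v (c zero))
    {s : ℕ} (s≥16 : 16 ≤ s) where

    open +-*-Solver using (solve; _:+_; _:*_; _:=_; con)
    open ℕ.≤-Reasoning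

    m = suc m′
    t = c zero

    private
      ∑ = ΣN.sum {m}

    -- The pair {c k, c (cpred k)} is stable in G; b k is its incidence vector.
    b : Fin m → Fin n → ℕ
    b k u = δ (c k) u + δ (c (cpred k)) u

    τ ν : Fin n → ℕ
    τ u = δ t u
    ν u = δ v u

    -- N, X and P are the entries of s Σₖ (1 , b k)(1 , b k)ᵀ + T, where T₀₀ = 3 and T₀ᵥ = Tᵥᵥ = Tᵥₜ = 8.
    N : ℕ
    N = s * m + 3

    X : Fin n → ℕ
    X u = s * ∑ (λ k → b k u) + 8 * ν u

    P : Fin n → Fin n → ℕ
    P x u = s * ∑ (λ k → b k x * b k u) + 8 * (ν x * (ν u + τ u) + τ x * ν u)

    b≤1 : ∀ k u → b k u ≤ 1
    b≤1 k = edge≤1 G (c-adj k)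

    b-v : ∀ k → b k v ≡ 0
    b-v k = ≡.cong₂ _+_ (δ-≢ (c≢v k)) (δ-≢ (c≢v (cpred k)))

    Σb≤2 : ∀ u → ∑ (λ k → b k u) ≤ 2
    Σb≤2 u = begin
      ∑ (λ k → b k u)                                         ≡⟨ ΣN.∑-distrib-+ (λ k → δ (c k) u) (λ k → δ (c (cpred k)) u) ⟩
      ∑ (λ k → δ (c k) u) + ∑ (λ k → δ (c (cpred k)) u)       ≤⟨ ℕ.+-mono-≤ (sumℕ-injective≤1 c-injective u)
                                                                    (sumℕ-injective≤1 (cpred-injective ∘ c-injective) u) ⟩
      2                                                       ∎

    Σb-v : ∑ (λ k → b k v) ≡ 0
    Σb-v = sumℕ-zero b-v

    Σb+2ν≤2 : ∀ u → ∑ (λ k → b k u) + 2 * ν u ≤ 2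
    Σb+2ν≤2 u with v ≟ u
    ... | yes refl = ℕ.≤-reflexive (≡.cong (_+ 2) Σb-v)
    ... | no  _    = ≡.subst (_≤ 2) (≡.sym (ℕ.+-identityʳ _)) (Σb≤2 u)

    private
      n*n≡n : ∀ {x} → x ≤ 1 → x * x ≡ x
      n*n≡n z≤n = refl
      n*n≡n (s≤s z≤n) = refl

    P-diagonal : ∀ u → P u u ≡ X u
    P-diagonal u = ≡.cong₂ _+_
      (≡.cong (s *_) (ΣN.sum-cong-≋ (λ k → n*n≡n (b≤1 k u))))
      (≡.cong (8 *_) ν-diagonal)
      where
      ν-diagonal : ν u * (ν u + τ u) + τ u * ν u ≡ ν u
      ν-diagonal with v ≟ u
      ... | yes refl rewrite δ-≢ (c≢v zero) = refl
      ... | no  _ = ℕ.*-zeroʳ (τ u)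

    P-sym : ∀ x u → P x u ≡ P u x
    P-sym x u = ≡.cong₂ _+_
      (≡.cong (s *_) (ΣN.sum-cong-≋ (λ k → ℕ.*-comm (b k x) (b k u))))
      (solve 4 (λ a b c d → con 8 :* (a :* (b :+ c) :+ d :* b) := con 8 :* (b :* (a :+ d) :+ c :* a))
         refl (ν x) (ν u) (τ u) (τ x))

    -- A 0/1-weight on the vertices, seen through its values on the pairs b k, on v and on t.
    -- It stands for a vertex or for the sum of two adjacent vertices.
    record Weight (A : Fin m → ℕ) (V T : ℕ) : Set where
      field
        A≤1    : ∀ k → A k ≤ 1
        V+T≤1  : V + T ≤ 1
        size   : ∑ A + 2 * V ≤ 4
        avoids : V ≡ 1 → ∃[ k ] b k t ≡ 1 × A k ≡ 0

    private
      -- Row `x` of `P`, summed over the one or two vertices that the weight stands for.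
      Pᴶ : Fin n → (Fin m → ℕ) → ℕ → ℕ → ℕ
      Pᴶ x A V T = s * ∑ (λ k → b k x * A k) + 8 * (ν x * (V + T) + τ x * V)

      p*q≤p : ∀ p {q} → q ≤ 1 → p * q ≤ p
      p*q≤p p {q} q≤1 = begin
        p * q ≤⟨ ℕ.*-monoʳ-≤ p q≤1 ⟩
        p * 1 ≡⟨ ℕ.*-identityʳ p ⟩
        p     ∎

      -- This is (1 - a) (1 - b) >= 0 without subtraction.
      slack : ∀ {a b} → a ≤ 1 → b ≤ 1 → a + b ≤ 1 + b * a
      slack z≤n z≤n = z≤n
      slack z≤n (s≤s z≤n) = s≤s z≤n
      slack (s≤s z≤n) z≤n = s≤s z≤n
      slack (s≤s z≤n) (s≤s z≤n) = s≤s (s≤s z≤n)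

    module _ {A V T} (w : Weight A V T) (x : Fin n) where
      open Weight w

      private
        V≤1 : V ≤ 1
        V≤1 = ℕ.≤-trans (ℕ.m≤m+n V T) V+T≤1

        ν-term : ν x * (V + T) ≤ ν x
        ν-term = p*q≤p (ν x) V+T≤1

        bA≤b : ∀ k → b k x * A k ≤ b k x
        bA≤b k = p*q≤p (b k x) (A≤1 k)

        ΣA Σb ΣbA : ℕ
        ΣA  = ∑ A
        Σb  = ∑ (λ k → b k x)
        ΣbA = ∑ (λ k → b k x * A k)

        column-easy : τ x * V ≡ 0 → Pᴶ x A V T ≤ X x
        column-easy τV≡0 = ℕ.+-mono-≤ (ℕ.*-monoʳ-≤ s (sumℕ-mono bA≤b)) (ℕ.*-monoʳ-≤ 8 (begin
          ν x * (V + T) + τ x * V  ≡⟨ ≡.cong (ν x * (V + T) +_) τV≡0 ⟩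
          ν x * (V + T) + 0        ≡⟨ ℕ.+-identityʳ _ ⟩
          ν x * (V + T)            ≤⟨ ν-term ⟩
          ν x                      ∎))

        column-hard : t ≡ x → V ≡ 1 → Pᴶ x A V T ≤ X x
        column-hard refl V≡1 = begin
          s * ΣbA + 8 * (ν x * (V + T) + τ x * V)
            ≤⟨ ℕ.+-monoʳ-≤ (s * ΣbA) (ℕ.*-monoʳ-≤ 8
                 (ℕ.+-mono-≤ ν-term (ℕ.*-mono-≤ (ℕ.≤-reflexive (δ-≡ {u = t} refl)) V≤1))) ⟩
          s * ΣbA + 8 * (ν x + 1)
            ≡⟨ solve 2 (λ a ν → a :+ con 8 :* (ν :+ con 1) := a :+ con 8 :+ con 8 :* ν) refl (s * ΣbA) (ν x) ⟩
          s * ΣbA + 8 + 8 * ν x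
            ≤⟨ ℕ.+-monoˡ-≤ (8 * ν x) (ℕ.+-monoʳ-≤ (s * ΣbA) (ℕ.≤-trans (ℕ.m≤m+n 8 8) s≥16)) ⟩
          s * ΣbA + s + 8 * ν x
            ≡⟨ ≡.cong (_+ 8 * ν x) (solve 2 (λ s a → s :* a :+ s := s :* (con 1 :+ a)) refl s ΣbA) ⟩
          s * suc ΣbA + 8 * ν x
            ≤⟨ ℕ.+-monoˡ-≤ (8 * ν x) (ℕ.*-monoʳ-≤ s (sumℕ-strict bA≤b k₀ bA<b)) ⟩
          X x ∎
          where
          k₀ = proj₁ (avoids V≡1)
          bA<b : b k₀ x * A k₀ < b k₀ x
          bA<b rewrite proj₂ (proj₂ (avoids V≡1)) | proj₁ (proj₂ (avoids V≡1)) = s≤s z≤n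

      column-bound : Pᴶ x A V T ≤ X x
      column-bound = cases (t ≟ x) (V ℕ.≟ 0)
        where
        cases : Dec (t ≡ x) → Dec (V ≡ 0) → Pᴶ x A V T ≤ X x
        cases (yes t≡x) (no V≢0) = column-hard t≡x (ℕ.≤-antisym V≤1 (ℕ.n≢0⇒n>0 V≢0))
        cases _ (yes V≡0) = column-easy (≡.trans (≡.cong (τ x *_) V≡0) (ℕ.*-zeroʳ (τ x)))
        cases (no t≢x) _ = column-easy (≡.cong (_* V) (δ-≢ t≢x))

      private
        Σ-slack : ΣA + Σb ≤ m + ΣbA
        Σ-slack = begin
          ΣA + Σb                       ≡⟨ ΣN.∑-distrib-+ A (λ k → b k x) ⟨
          ∑ (λ k → A k + b k x)         ≤⟨ sumℕ-mono (λ k → slack (A≤1 k) (b≤1 k x)) ⟩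
          ∑ (λ k → 1 + b k x * A k)     ≡⟨ ΣN.∑-distrib-+ (λ _ → 1) (λ k → b k x * A k) ⟩
          ∑ (λ _ → 1) + ΣbA             ≡⟨ ≡.cong (_+ ΣbA) (sumℕ-one m) ⟩
          m + ΣbA                       ∎

        regroup : s * ΣA + 8 * V + X x ≡ s * (ΣA + Σb) + 8 * (V + ν x)
        regroup = solve 5 (λ s a b v w → s :* a :+ con 8 :* v :+ (s :* b :+ con 8 :* w) :=
                            s :* (a :+ b) :+ con 8 :* (v :+ w)) refl s ΣA Σb V (ν x)

        ν≤1 : ν x ≤ 1
        ν≤1 with v ≟ x
        ... | yes _ = s≤s z≤n
        ... | no  _ = z≤n

        -- Once v is involved, the size bounds 4 and 2 lose at least 2 to v, so `ΣA + Σb` is at most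
        -- 4, below the cycle length m >= 5. The unit gained, multiplied by s >= 16, absorbs
        -- `8 * (V + ν x)`.
        Σ-strict : 1 ≤ V + ν x → suc (ΣA + Σb) ≤ m + ΣbA
        Σ-strict 1≤ = ℕ.≤-trans (s≤s (ℕ.+-cancelʳ-≤ 2 (ΣA + Σb) 4 (begin
          ΣA + Σb + 2                     ≤⟨ ℕ.+-monoʳ-≤ (ΣA + Σb) (ℕ.*-monoʳ-≤ 2 1≤) ⟩
          ΣA + Σb + 2 * (V + ν x)         ≡⟨ solve 4 (λ a b v w → a :+ b :+ con 2 :* (v :+ w) :=
                                               a :+ con 2 :* v :+ (b :+ con 2 :* w)) refl ΣA Σb V (ν x) ⟩
          ΣA + 2 * V + (Σb + 2 * ν x)     ≤⟨ ℕ.+-mono-≤ size (Σb+2ν≤2 x) ⟩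
          6                               ∎))) (ℕ.≤-trans (s≤s m′≥4) (ℕ.m≤m+n m ΣbA))

      complement-bound : s * ∑ A + 8 * V + X x ≤ N + Pᴶ x A V T
      complement-bound = begin
        s * ΣA + 8 * V + X x           ≡⟨ regroup ⟩
        s * (ΣA + Σb) + 8 * (V + ν x)  ≤⟨ cases (V + ν x ℕ.≟ 0) ⟩
        s * (m + ΣbA)                  ≤⟨ ℕ.m≤m+n _ _ ⟩
        s * (m + ΣbA) + (3 + 8 * (ν x * (V + T) + τ x * V))
          ≡⟨ solve 4 (λ s m a r → s :* (m :+ a) :+ (con 3 :+ r) := s :* m :+ con 3 :+ (s :* a :+ r))
               refl s m ΣbA (8 * (ν x * (V + T) + τ x * V)) ⟩
        N + Pᴶ x A V T                 ∎
        where
        cases : Dec (V + ν x ≡ 0) → s * (ΣA + Σb) + 8 * (V + ν x) ≤ s * (m + ΣbA)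
        cases (yes ≡0) rewrite ≡0 = ≡.subst (_≤ s * (m + ΣbA)) (≡.sym (ℕ.+-identityʳ _))
          (ℕ.*-monoʳ-≤ s Σ-slack)
        cases (no ≢0) = begin
          s * (ΣA + Σb) + 8 * (V + ν x)  ≤⟨ ℕ.+-monoʳ-≤ (s * (ΣA + Σb))
                                              (ℕ.≤-trans (ℕ.*-monoʳ-≤ 8 (ℕ.+-mono-≤ V≤1 ν≤1)) s≥16) ⟩
          s * (ΣA + Σb) + s              ≡⟨ solve 2 (λ s a → s :* a :+ s := s :* (con 1 :+ a)) refl s (ΣA + Σb) ⟩
          s * suc (ΣA + Σb)              ≤⟨ ℕ.*-monoʳ-≤ s (Σ-strict (ℕ.n≢0⇒n>0 ≢0)) ⟩
          s * (m + ΣbA)                  ∎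

    private
      second : 2 ≤ m′ → ∃[ k ] cpred {m′} k ≡ zero × k ≢ fromℕ m′ × k ≢ zero
      second (s≤s (s≤s _)) = suc zero , refl , (λ ()) , λ ()

      -- The pairs with index 0 and 1 both contain t, and their other members are distinct. Hence a
      -- vertex other than t is missed by one of them.
      avoid : ∀ w → t ≢ w → ∃[ k ] b k t ≡ 1 × b k w ≡ 0
      avoid w t≢w with c (fromℕ m′) ≟ w
      ... | no last≢w = zero ,
        ℕ.≤-antisym (b≤1 zero t) (ℕ.≤-trans (ℕ.≤-reflexive (≡.sym (δ-≡ {u = t} refl))) (ℕ.m≤m+n _ _)) ,
        ≡.cong₂ _+_ (δ-≢ t≢w) (δ-≢ last≢w)
      ... | yes last≡w with second (ℕ.≤-trans (s≤s (s≤s z≤n)) m′≥4)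
      ...   | k , pk≡0 , k≢last , k≢0 = k ,
        ℕ.≤-antisym (b≤1 k t) (ℕ.≤-trans
          (ℕ.≤-reflexive (≡.sym (δ-≡ {u = c (cpred k)} (≡.cong c pk≡0)))) (ℕ.m≤n+m _ _)) ,
        ≡.cong₂ _+_ (δ-≢ (λ cₖ≡w → k≢last (c-injective (≡.trans cₖ≡w (≡.sym last≡w)))))
                    (δ-≢ (λ eq → t≢w (≡.trans (≡.cong c (≡.sym pk≡0)) eq)))

      ν≡1⇒≡v : ∀ {u} → ν u ≡ 1 → v ≡ u
      ν≡1⇒≡v {u} ν≡1 with v ≟ u
      ... | yes v≡u = v≡u

    vertex-weight : ∀ u → Weight (λ k → b k u) (ν u) (τ u)
    vertex-weight u = record
      { A≤1    = λ k → b≤1 k u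
      ; V+T≤1  = edge≤1 G vt u
      ; size   = ℕ.≤-trans (Σb+2ν≤2 u) (ℕ.m≤m+n 2 2)
      ; avoids = λ ν≡1 → avoid u (λ t≡u → c≢v zero (≡.trans t≡u (≡.sym (ν≡1⇒≡v ν≡1))))
      }

    edge-weight : ∀ {u w} → Adj G u w →
                  Weight (λ k → b k u + b k w) (ν u + ν w) (τ u + τ w)
    edge-weight {u} {w} uw = record
      { A≤1    = λ k → edge-adjacent≤1 G (c-adj k) uw
      ; V+T≤1  = ≡.subst (_≤ 1) (solve 4 (λ a b c d → a :+ b :+ (c :+ d) := a :+ c :+ (b :+ d))
                   refl (ν u) (τ u) (ν w) (τ w)) (edge-adjacent≤1 G vt uw)
      ; size   = ≡.subst (_≤ 4) size-eq (ℕ.+-mono-≤ (Σb+2ν≤2 u) (Σb+2ν≤2 w))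
      ; avoids = avoids
      }
      where
      size-eq : ∑ (λ k → b k u) + 2 * ν u + (∑ (λ k → b k w) + 2 * ν w)
                ≡ ∑ (λ k → b k u + b k w) + 2 * (ν u + ν w)
      size-eq = ≡.trans
        (solve 4 (λ a b c d → a :+ con 2 :* b :+ (c :+ con 2 :* d) := a :+ c :+ con 2 :* (b :+ d))
          refl (∑ (λ k → b k u)) (ν u) (∑ (λ k → b k w)) (ν w))
        (≡.cong (_+ 2 * (ν u + ν w)) (≡.sym (ΣN.∑-distrib-+ (λ k → b k u) (λ k → b k w))))

      -- The other end of a G-edge at v is not t, because vt is an edge of the complement. So
      -- `avoid` applies to that end, and v itself lies in no pair.
      t≢nbr : ∀ {x} → Adj G v x → t ≢ x
      t≢nbr vx refl = proj₂ vt vx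

      avoids : ν u + ν w ≡ 1 → ∃[ k ] b k t ≡ 1 × b k u + b k w ≡ 0
      avoids νν≡1 with v ≟ u
      ... | yes refl = let k , eq₁ , eq₀ = avoid w (t≢nbr uw) in k , eq₁ , ≡.cong₂ _+_ (b-v k) eq₀
      ... | no _ with ν≡1⇒≡v {w} νν≡1
      ...   | refl = let k , eq₁ , eq₀ = avoid u (t≢nbr (Graph.~-sym G uw)) in k , eq₁ , ≡.cong₂ _+_ eq₀ (b-v k)

    private
      ΣbA-+ : ∀ x u w → ∑ (λ k → b k x * (b k u + b k w)) ≡
                        ∑ (λ k → b k x * b k u) + ∑ (λ k → b k x * b k w)
      ΣbA-+ x u w = ≡.trans (ΣN.sum-cong-≋ (λ k → ℕ.*-distribˡ-+ (b k x) (b k u) (b k w)))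
                            (ΣN.∑-distrib-+ (λ k → b k x * b k u) (λ k → b k x * b k w))

      P-+ : ∀ x u w → P x u + P x w ≡ Pᴶ x (λ k → b k u + b k w) (ν u + ν w) (τ u + τ w)
      P-+ x u w rewrite ΣbA-+ x u w = solve 9 (λ s a a′ ν τ νu νw τu τw →
          s :* a :+ con 8 :* (ν :* (νu :+ τu) :+ τ :* νu) :+ (s :* a′ :+ con 8 :* (ν :* (νw :+ τw) :+ τ :* νw)) :=
          s :* (a :+ a′) :+ con 8 :* (ν :* (νu :+ νw :+ (τu :+ τw)) :+ τ :* (νu :+ νw)))
        refl s (∑ (λ k → b k x * b k u)) (∑ (λ k → b k x * b k w)) (ν x) (τ x) (ν u) (ν w) (τ u) (τ w)

      X-+ : ∀ u w → X u + X w ≡ s * ∑ (λ k → b k u + b k w) + 8 * (ν u + ν w)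
      X-+ u w rewrite ΣN.∑-distrib-+ (λ k → b k u) (λ k → b k w) = solve 5 (λ s a a′ ν ν′ →
          s :* a :+ con 8 :* ν :+ (s :* a′ :+ con 8 :* ν′) := s :* (a :+ a′) :+ con 8 :* (ν :+ ν′))
        refl s (∑ (λ k → b k u)) (∑ (λ k → b k w)) (ν u) (ν w)

    P≤X : ∀ x u → P x u ≤ X x
    P≤X x u = column-bound (vertex-weight u) x

    P+P≤X : ∀ x {u w} → Adj G u w → P x u + P x w ≤ X x
    P+P≤X x {u} {w} uw = ≡.subst (_≤ X x) (≡.sym (P-+ x u w)) (column-bound (edge-weight uw) x)

    X+X≤N+P : ∀ x u → X u + X x ≤ N + P x u
    X+X≤N+P x u = complement-bound (vertex-weight u) x

    X+X+X≤N+P+P : ∀ x {u w} → Adj G u w → X u + X w + X x ≤ N + (P x u + P x w)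
    X+X+X≤N+P+P x {u} {w} uw = ≡.subst₂ _≤_ (≡.cong (_+ X x) (≡.sym (X-+ u w)))
      (≡.cong (N +_) (≡.sym (P-+ x u w))) (complement-bound (edge-weight uw) x)

    X≤N : ∀ u → X u ≤ N
    X≤N u = ℕ.+-cancelʳ-≤ (X u) (X u) N (≡.subst (X u + X u ≤_) (≡.cong (N +_) (P-diagonal u)) (X+X≤N+P u u))

    -- Each of the m pairs contributes 2 s and v contributes 8, that is 2 (s m + 3) + 2. The surplus
    -- 2 over `2 * N` is what lies beyond the stable set polytope.
    ΣX : ΣN.sum X ≡ 2 * N + 2
    ΣX = ≡.trans (ΣN.∑-distrib-+ (λ u → s * ∑ (λ k → b k u)) (λ u → 8 * ν u)) (≡.trans
      (≡.cong₂ _+_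
        (≡.trans (≡.sym (ΣN.*-distribˡ-sum s (λ u → ∑ (λ k → b k u)))) (≡.cong (s *_) ΣΣb))
        (≡.trans (≡.sym (ΣN.*-distribˡ-sum 8 ν)) (≡.cong (8 *_) (sumℕ-δ v))))
      (solve 2 (λ s m → s :* (m :* con 2) :+ con 8 := con 2 :* (s :* m :+ con 3) :+ con 2) refl s m))
      where
      ΣΣb : ΣN.sum (λ u → ∑ (λ k → b k u)) ≡ m * 2
      ΣΣb = begin-equality
        ΣN.sum (λ u → ∑ (λ k → b k u))  ≡⟨ ΣN.∑-comm (λ u k → b k u) ⟩
        ∑ (λ k → ΣN.sum (b k))          ≡⟨ ΣN.sum-cong-≋ (λ k → ≡.trans
                                             (ΣN.∑-distrib-+ (δ (c k)) (δ (c (cpred k))))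
                                             (≡.cong₂ _+_ (sumℕ-δ (c k)) (sumℕ-δ (c (cpred k))))) ⟩
        ∑ (λ _ → 2)                     ≡⟨ ΣN.*-distribʳ-sum {m} 2 (λ _ → 1) ⟨
        ∑ (λ _ → 1) * 2                 ≡⟨ ≡.cong (_* 2) (sumℕ-one m) ⟩
        m * 2                           ∎

    W : Fin (suc n) → Fin (suc n) → ℕ
    W zero    zero    = N
    W zero    (suc u) = X u
    W (suc x) zero    = X x
    W (suc x) (suc u) = P x u

    β : Fin m → Fin (suc n) → ℕ
    β k zero    = 1
    β k (suc u) = b k u

    -- Where z_t = - z_0 / 2, these read z_v + z_0 / 2, - z_0 and 0. The coefficients 8, 1 and - 6
    -- of their squares cancel at (0, t) and (t, t), where T is zero.
    γ η ζ : Fin (suc n) → ℕ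
    γ zero    = 1
    γ (suc u) = τ u + ν u
    η zero    = 1
    η (suc u) = 4 * τ u
    ζ zero    = 1
    ζ (suc u) = 2 * τ u

    -- The only negative part of T is - 6 ζζᵀ; since ζ reads off twice the deviation at t, it is
    -- dominated by the term with β (see odd-cycle-bound).
    W-decomposition : ∀ i j → W i j + 6 * (ζ i * ζ j) ≡
                      s * ∑ (λ k → β k i * β k j) + 8 * (γ i * γ j) + η i * η j
    W-decomposition zero zero = ≡.trans (ℕ.+-assoc (s * m) 3 6) (≡.trans
      (≡.cong (λ r → s * r + 9) (≡.sym (sumℕ-one m))) (≡.sym (ℕ.+-assoc (s * ∑ (λ _ → 1)) 8 1)))
    W-decomposition zero (suc u) = ≡.trans
      (solve 4 (λ s a τ ν → s :* a :+ con 8 :* ν :+ con 6 :* (con 1 :* (con 2 :* τ)) :=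
                            s :* a :+ con 8 :* (con 1 :* (τ :+ ν)) :+ con 1 :* (con 4 :* τ))
        refl s (∑ (λ k → b k u)) (τ u) (ν u))
      (≡.cong (λ r → s * r + 8 * (1 * γ (suc u)) + 1 * η (suc u))
        (ΣN.sum-cong-≋ (λ k → ≡.sym (ℕ.*-identityˡ (b k u)))))
    W-decomposition (suc x) zero = ≡.trans
      (solve 4 (λ s a τ ν → s :* a :+ con 8 :* ν :+ con 6 :* (con 2 :* τ :* con 1) :=
                            s :* a :+ con 8 :* ((τ :+ ν) :* con 1) :+ con 4 :* τ :* con 1)
        refl s (∑ (λ k → b k x)) (τ x) (ν x))
      (≡.cong (λ r → s * r + 8 * (γ (suc x) * 1) + η (suc x) * 1)
        (ΣN.sum-cong-≋ (λ k → ≡.sym (ℕ.*-identityʳ (b k x)))))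
    W-decomposition (suc x) (suc u) =
      solve 6 (λ s a τ ν τ′ ν′ →
        s :* a :+ con 8 :* (ν :* (ν′ :+ τ′) :+ τ :* ν′) :+ con 6 :* (con 2 :* τ :* (con 2 :* τ′)) :=
        s :* a :+ con 8 :* ((τ :+ ν) :* (τ′ :+ ν′)) :+ con 4 :* τ :* (con 4 :* τ′))
        refl s (∑ (λ k → b k x * b k u)) (τ x) (ν x) (τ u) (ν u)

open PendantCycle

-- From the certificate to the failure of LS₊-perfection.

module LS₊-Imperfection {c ℓ₁ ℓ₂} (R : RealField c ℓ₁ ℓ₂) {n} (G : Graph (Fin n)) where

  open RealField R hiding (zero)
  open FieldProperties R
  open LinearAlgebra R
  open QuadraticForm R
  open Solver using (solve; _:+_; _:*_; _:-_; :-_; _:=_; con)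
  open ≤-Reasoning

  sum-incidence : ∀ {n} (S : Subset n) → sum (incidence R S) ≈ ι ∣ S ∣
  sum-incidence []          = ≈-refl
  sum-incidence (true ∷ S)  = +-congˡ (sum-incidence S)
  sum-incidence (false ∷ S) = ≈-trans (+-identityˡ _) (sum-incidence S)

  STAB-sum : ∀ {k} → (∀ S → Stable G S → ∣ S ∣ ℕ.≤ k) → ∀ {x} → STAB R G x → sum x ≤ ι k
  STAB-sum {k} bound {x} (l , p , w , p∈ , 0≤w , Σw≈1 , x≈) = begin
    sum x                                       ≈⟨ sum-cong-≋ (λ j → ≈-trans (x≈ j) (≈-sym (*-identityˡ _))) ⟩
    sum (λ j → 1# * sum (λ i → w i * p i j))    ≈⟨ dot-sum (λ _ → 1#) w p ⟩
    sum (λ i → w i * dot R (λ _ → 1#) (p i))    ≤⟨ sum-mono (λ i → *-monoˡ-≤ (0≤w i) (size i)) ⟩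
    sum (λ i → w i * ι k)                       ≈⟨ *-distribʳ-sum (ι k) w ⟨
    sum w * ι k                                 ≈⟨ *-congʳ Σw≈1 ⟩
    1# * ι k                                    ≈⟨ *-identityˡ _ ⟩
    ι k                                         ∎
    where
    size : ∀ i → dot R (λ _ → 1#) (p i) ≤ ι k
    size i = begin
      sum (λ j → 1# * p i j)               ≈⟨ sum-cong-≋ (λ j → ≈-trans (*-identityˡ _) (proj₂ (proj₂ (p∈ i)) j)) ⟩
      sum (incidence R (proj₁ (p∈ i)))     ≈⟨ sum-incidence (proj₁ (p∈ i)) ⟩
      ι ∣ proj₁ (p∈ i) ∣                   ≤⟨ ι-mono (bound _ (proj₁ (proj₂ (p∈ i)))) ⟩
      ι k                                  ∎

  -- Division by z₀ yields the point of `ESTAB`. If z₀ = 0, the bounds force all of z to be zero,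
  -- and the origin serves as the point.
  cone-ESTAB : ∀ (z : Point R (suc n)) → 0# ≤ z zero → (∀ u → 0# ≤ z (suc u)) →
               (∀ u → z (suc u) ≤ z zero) →
               (∀ u w → Adj G u w → z (suc u) + z (suc w) ≤ z zero) →
               cone R (ESTAB R G) z
  cone-ESTAB z 0≤z₀ 0≤z z≤z₀ edge with z zero ≈? 0#
  ... | yes z₀≈0 = (λ _ → 0#) ,
        ((λ _ → ≤-refl , 0≤1) , λ _ _ _ → ≤-resp-≈ (≈-sym (+-identityˡ 0#)) ≈-refl 0≤1) ,
        λ u → ≈-trans (≤-antisym (≤-trans (z≤z₀ u) (≤-reflexive z₀≈0)) (0≤z u)) (≈-sym (zeroʳ _))
  ... | no z₀≉0 with inverse (z zero) z₀≉0
  ...   | ρ , z₀ρ≈1 = (λ u → ρ * z (suc u)) ,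
        ((λ u → *-nonNeg 0≤ρ (0≤z u) , ≤-resp-≈ ≈-refl ρz₀≈1 (*-monoˡ-≤ 0≤ρ (z≤z₀ u))) ,
         (λ u w uw → ≤-resp-≈ (distribˡ ρ _ _) ρz₀≈1 (*-monoˡ-≤ 0≤ρ (edge u w uw)))) ,
        λ u → ≈-sym (≈-trans (≈-sym (*-assoc _ _ _)) (≈-trans (*-congʳ z₀ρ≈1) (*-identityˡ _)))
    where
    0≤ρ = inverse-nonNeg 0≤z₀ z₀ρ≈1
    ρz₀≈1 = ≈-trans (*-comm ρ (z zero)) z₀ρ≈1

  module _ {m′} (m′≥4 : 4 ℕ.≤ m′) (m′-even : sgn m′ ≈ 1#)
    {c : Fin (suc m′) → Fin n} (c-injective : Injective _≡_ _≡_ c)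
    (c-adj : ∀ a → Adj (complement G) (c a) (c (cpred a)))
    {v} (c≢v : ∀ a → c a ≢ v) (vt : Adj (complement G) v (c zero)) where

    private
      -- 24 = 6 · 4, where 6 is the weight of ζζᵀ, and 4 and the power of 2 come from odd-cycle-bound.
      s : ℕ
      s = 24 ℕ.* 2 ℕ.^ suc m′

      s≥16 : 16 ℕ.≤ s
      s≥16 = ℕ.≤-trans (ℕ.m≤m+n 16 8) (ℕ.*-monoʳ-≤ 24 (ℕ.m^n>0 2 (suc m′)))

    open CycleWithPendant G m′≥4 c-injective c-adj c≢v vt s≥16

    module _ (z : Point R (suc n)) where

      private
        _∙ : (Fin (suc n) → ℕ) → Carrier
        f ∙ = dot R z (ι ∘ f)

        outer : (Fin (suc n) → ℕ) → Matrix R (suc n)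
        outer f i j = ι (f i) * ι (f j)

        dot-δ : ∀ a → sum (λ u → z (suc u) * ι (δ a u)) ≈ z (suc a)
        dot-δ a = ≈-trans
          (sum-single a (λ u u≢a → ≈-trans (*-congˡ (reflexive (≡.cong ι (δ-≢ (u≢a ∘ ≡.sym))))) (zeroʳ _)))
          (≈-trans (*-congˡ (≈-trans (reflexive (≡.cong ι (δ-≡ {u = a} ≡.refl))) ι-1)) (*-identityʳ _))

        -- Twice the deviation of z from - z₀ / 2 along the cycle. Its edge sums are twice the
        -- products of z with the vectors `β k`, which brings `odd-cycle-bound` into play.
        x : Vector Carrier m
        x k = z zero + ι 2 * z (suc (c k))

        dot-head : z zero * ι 1 ≈ z zero
        dot-head = ≈-trans (*-congˡ ι-1) (*-identityʳ _)

        ζ∙ : ζ ∙ ≈ x zero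
        ζ∙ = +-cong dot-head (begin-equality
          sum (λ u → z (suc u) * ι (2 ℕ.* τ u))
            ≈⟨ sum-cong-≋ (λ u → ≈-trans (*-congˡ (ι-* 2 (τ u)))
                 (solve 3 (λ z k t → z :* (k :* t) := k :* (z :* t)) ≈-refl (z (suc u)) (ι 2) (ι (τ u)))) ⟩
          sum (λ u → ι 2 * (z (suc u) * ι (τ u)))
            ≈⟨ *-distribˡ-sum (ι 2) (λ u → z (suc u) * ι (τ u)) ⟨
          ι 2 * sum (λ u → z (suc u) * ι (τ u))
            ≈⟨ *-congˡ (dot-δ t) ⟩
          ι 2 * z (suc t) ∎)

        β∙ : ∀ k → x k + x (cpred k) ≈ ι 2 * (β k ∙)
        β∙ k = begin-equality
          x k + x (cpred k)
            ≈⟨ solve 3 (λ z a b → z :+ con (+ 2) :* a :+ (z :+ con (+ 2) :* b) := con (+ 2) :* (z :+ (a :+ b)))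
                 ≈-refl (z zero) (z (suc (c k))) (z (suc (c (cpred k)))) ⟩
          ι 2 * (z zero + (z (suc (c k)) + z (suc (c (cpred k)))))
            ≈⟨ *-congˡ (+-cong dot-head (+-cong (dot-δ (c k)) (dot-δ (c (cpred k))))) ⟨
          ι 2 * (z zero * ι 1 +
            (sum (λ u → z (suc u) * ι (δ (c k) u)) + sum (λ u → z (suc u) * ι (δ (c (cpred k)) u))))
            ≈⟨ *-congˡ (+-congˡ (≈-trans
                 (sum-cong-≋ (λ u → ≈-trans (*-congˡ (ι-+ (δ (c k) u) (δ (c (cpred k)) u))) (distribˡ _ _ _)))
                 (∑-distrib-+ (λ u → z (suc u) * ι (δ (c k) u)) (λ u → z (suc u) * ι (δ (c (cpred k)) u))))) ⟨
          ι 2 * (β k ∙) ∎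

        Σβ² : Carrier
        Σβ² = sum (λ k → (β k ∙) * (β k ∙))

        6ζ²≤sΣβ² : ι 6 * ((ζ ∙) * (ζ ∙)) ≤ ι s * Σβ²
        6ζ²≤sΣβ² = begin
          ι 6 * ((ζ ∙) * (ζ ∙))                ≈⟨ *-congˡ (*-cong ζ∙ ζ∙) ⟩
          -- Weakening x^2 to (2 x)^2 matches the left side of `odd-cycle-bound`; after the factor 6
          -- the difference is 18 x^2.
          ι 6 * (x zero * x zero)              ≤⟨ 0≤-⇒≤ (≤-resp-≈ ≈-refl
              (solve 1 (λ x → con (+ 18) :* (x :* x) :=
                con (+ 6) :* ((con (+ 2) :* x) :* (con (+ 2) :* x)) :- con (+ 6) :* (x :* x)) ≈-refl (x zero))
              (*-nonNeg (0≤ι 18) (0≤x*x (x zero)))) ⟩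
          ι 6 * ((ι 2 * x zero) * (ι 2 * x zero)) ≤⟨ *-monoˡ-≤ (0≤ι 6) (odd-cycle-bound x m′-even) ⟩
          ι 6 * (ι K * sum (λ k → (x k + x (cpred k)) * (x k + x (cpred k))))
            ≈⟨ *-congˡ (*-congˡ (sum-cong-≋ (λ k → ≈-trans (*-cong (β∙ k) (β∙ k))
                 (solve 1 (λ y → (con (+ 2) :* y) :* (con (+ 2) :* y) := con (+ 4) :* (y :* y)) ≈-refl (β k ∙))))) ⟩
          ι 6 * (ι K * sum (λ k → ι 4 * ((β k ∙) * (β k ∙))))
            ≈⟨ *-congˡ (*-congˡ (*-distribˡ-sum (ι 4) (λ k → (β k ∙) * (β k ∙)))) ⟨
          ι 6 * (ι K * (ι 4 * Σβ²))
            ≈⟨ solve 2 (λ k q → con (+ 6) :* (k :* (con (+ 4) :* q)) := con (+ 24) :* k :* q) ≈-refl (ι K) Σβ² ⟩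
          ι 24 * ι K * Σβ²                     ≈⟨ *-congʳ (ι-* 24 K) ⟨
          ι s * Σβ²                            ∎
          where K = 2 ℕ.^ suc m′

        ι-decomposition : ∀ i j →
          ι (W i j) + ι 6 * outer ζ i j ≈
          ι s * sum (λ k → outer (β k) i j) + ι 8 * outer γ i j + outer η i j
        ι-decomposition i j = begin-equality
          ι (W i j) + ι 6 * outer ζ i j            ≈⟨ +-congˡ (*-congˡ (ι-* (ζ i) (ζ j))) ⟨
          ι (W i j) + ι 6 * ι (ζ i ℕ.* ζ j)        ≈⟨ +-congˡ (ι-* 6 (ζ i ℕ.* ζ j)) ⟨
          ι (W i j) + ι (6 ℕ.* (ζ i ℕ.* ζ j))      ≈⟨ ι-+ (W i j) _ ⟨
          ι (W i j ℕ.+ 6 ℕ.* (ζ i ℕ.* ζ j))        ≡⟨ ≡.cong ι (W-decomposition i j) ⟩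
          ι (s ℕ.* Σββ ℕ.+ 8 ℕ.* (γ i ℕ.* γ j) ℕ.+ η i ℕ.* η j)
            ≈⟨ ι-+ (s ℕ.* Σββ ℕ.+ 8 ℕ.* (γ i ℕ.* γ j)) (η i ℕ.* η j) ⟩
          ι (s ℕ.* Σββ ℕ.+ 8 ℕ.* (γ i ℕ.* γ j)) + ι (η i ℕ.* η j)
            ≈⟨ +-cong (≈-trans (ι-+ (s ℕ.* Σββ) (8 ℕ.* (γ i ℕ.* γ j))) (+-cong
                 (≈-trans (ι-* s Σββ) (*-congˡ (≈-trans (ι-sum (λ k → β k i ℕ.* β k j))
                   (sum-cong-≋ (λ k → ι-* (β k i) (β k j))))))
                 (≈-trans (ι-* 8 (γ i ℕ.* γ j)) (*-congˡ (ι-* (γ i) (γ j)))))) (ι-* (η i) (η j)) ⟩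
          ι s * sum (λ k → outer (β k) i j) + ι 8 * outer γ i j + outer η i j ∎
          where Σββ = ΣN.sum (λ k → β k i ℕ.* β k j)

      W-nonNeg : 0# ≤ Q z (λ i j → ι (W i j))
      W-nonNeg = +-cancelʳ-≤ (ι 6 * ((ζ ∙) * (ζ ∙))) (begin
        0# + ι 6 * ((ζ ∙) * (ζ ∙))      ≈⟨ +-identityˡ _ ⟩
        ι 6 * ((ζ ∙) * (ζ ∙))           ≤⟨ 6ζ²≤sΣβ² ⟩
        ι s * Σβ²                       ≈⟨ ≈-trans (+-identityʳ _) (+-identityʳ _) ⟨
        ι s * Σβ² + 0# + 0#             ≤⟨ +-mono-≤ (+-monoʳ-≤ _ (*-nonNeg (0≤ι 8) (0≤x*x (γ ∙)))) (0≤x*x (η ∙)) ⟩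
        ι s * Σβ² + ι 8 * ((γ ∙) * (γ ∙)) + (η ∙) * (η ∙)
          ≈⟨ +-cong (+-cong (*-congˡ (sum-cong-≋ (λ k → Q-outer z (ι ∘ β k)))) (*-congˡ (Q-outer z (ι ∘ γ))))
                    (Q-outer z (ι ∘ η)) ⟨
        ι s * sum (λ k → Q z (outer (β k))) + ι 8 * Q z (outer γ) + Q z (outer η)
          ≈⟨ +-congʳ (+-cong (≈-trans (Q-scale z (ι s) B) (*-congˡ (Q-sum z (outer ∘ β))))
                             (Q-scale z (ι 8) (outer γ))) ⟨
        Q z sB + Q z 8C + Q z (outer η)
          ≈⟨ +-congʳ (Q-+ z sB 8C) ⟨
        Q z (λ i j → sB i j + 8C i j) + Q z (outer η)
          ≈⟨ Q-+ z (λ i j → sB i j + 8C i j) (outer η) ⟨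
        Q z (λ i j → sB i j + 8C i j + outer η i j)
          ≈⟨ Q-cong z ι-decomposition ⟨
        Q z (λ i j → ι (W i j) + 6Z i j)
          ≈⟨ Q-+ z (λ i j → ι (W i j)) 6Z ⟩
        Q z (λ i j → ι (W i j)) + Q z 6Z
          ≈⟨ +-congˡ (≈-trans (Q-scale z (ι 6) (outer ζ)) (*-congˡ (Q-outer z (ι ∘ ζ)))) ⟩
        Q z (λ i j → ι (W i j)) + ι 6 * ((ζ ∙) * (ζ ∙)) ∎)
        where
        B sB 8C 6Z : Matrix R (suc n)
        B i j  = sum (λ k → outer (β k) i j)
        sB i j = ι s * B i j
        8C i j = ι 8 * outer γ i j
        6Z i j = ι 6 * outer ζ i j

    private
      ιN≉0 : ¬ (ι N ≈ 0#)
      ιN≉0 ιN≈0 with ι-cancel-≤ {N} {0} (≤-reflexive ιN≈0)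
      ... | N≤0 = contradiction (ℕ.≤-trans (ℕ.m≤n+m 3 (s ℕ.* m)) N≤0) λ ()

      D : Carrier
      D = proj₁ (inverse (ι N) ιN≉0)

      ND≈1 : ι N * D ≈ 1#
      ND≈1 = proj₂ (inverse (ι N) ιN≉0)

      0≤D : 0# ≤ D
      0≤D = inverse-nonNeg (0≤ι N) ND≈1

      scale : ℕ → Carrier
      scale k = ι k * D

      scale-nonNeg : ∀ k → 0# ≤ scale k
      scale-nonNeg k = *-nonNeg (0≤ι k) 0≤D

      scale-mono : ∀ {k l} → k ℕ.≤ l → scale k ≤ scale l
      scale-mono k≤l = ≤-resp-≈ (*-comm _ _) (*-comm _ _) (*-monoˡ-≤ 0≤D (ι-mono k≤l))

      scale-+ : ∀ k l → scale (k ℕ.+ l) ≈ scale k + scale l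
      scale-+ k l = ≈-trans (*-congʳ (ι-+ k l)) (distribʳ D _ _)

      -- The entries of the column of e_0 - e_i are differences. Moving the subtracted terms across
      -- turns the cone conditions into inequalities in ℕ.
      scale-difference : ∀ {a b c d} → a ℕ.+ d ℕ.≤ c ℕ.+ b → scale a - scale b ≤ scale c - scale d
      scale-difference {a} {b} {c} {d} a+d≤c+b = +-cancelʳ-≤ (scale b + scale d) (begin
        scale a - scale b + (scale b + scale d)
          ≈⟨ solve 3 (λ a b d → a :- b :+ (b :+ d) := a :+ d) ≈-refl (scale a) (scale b) (scale d) ⟩
        scale a + scale d       ≈⟨ scale-+ a d ⟨
        scale (a ℕ.+ d)         ≤⟨ scale-mono a+d≤c+b ⟩
        scale (c ℕ.+ b)         ≈⟨ scale-+ c b ⟩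
        scale c + scale b
          ≈⟨ solve 3 (λ b c d → c :- d :+ (b :+ d) := c :+ b) ≈-refl (scale b) (scale c) (scale d) ⟨
        scale c - scale d + (scale b + scale d) ∎)

      scale-difference₂ : ∀ {a a′ b b′ c d} → a ℕ.+ a′ ℕ.+ d ℕ.≤ c ℕ.+ (b ℕ.+ b′) →
        scale a - scale b + (scale a′ - scale b′) ≤ scale c - scale d
      scale-difference₂ {a} {a′} {b} {b′} {c} {d} le = ≤-resp-≈
        (≈-trans (+-cong (scale-+ a a′) (-‿cong (scale-+ b b′)))
          (solve 4 (λ a a′ b b′ → a :+ a′ :- (b :+ b′) := a :- b :+ (a′ :- b′))
            ≈-refl (scale a) (scale a′) (scale b) (scale b′)))
        ≈-refl (scale-difference {a ℕ.+ a′} {b ℕ.+ b′} {c} {d} le)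

      Y : Matrix R (suc n)
      Y i j = scale (W i j)

      W-sym : ∀ i j → W i j ≡ W j i
      W-sym zero    zero    = ≡.refl
      W-sym zero    (suc u) = ≡.refl
      W-sym (suc x) zero    = ≡.refl
      W-sym (suc x) (suc u) = P-sym x u

      Y-psd : PositiveSemidefinite R Y
      Y-psd = (λ i j → reflexive (≡.cong scale (W-sym i j))) , λ z →
        ≤-resp-≈ ≈-refl
          (≈-trans (≈-sym (Q-scale z D (λ i j → ι (W i j)))) (Q-cong z (λ i j → *-comm D (ι (W i j)))))
          (*-nonNeg 0≤D (W-nonNeg z))

      column-in-cone : ∀ x → cone R (ESTAB R G) (column R Y (suc x))
      column-in-cone x = cone-ESTAB (column R Y (suc x)) (scale-nonNeg (X x)) (λ u → scale-nonNeg (P u x))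
        (λ u → ≤-resp-≈ (P-swap u) ≈-refl (scale-mono (P≤X x u)))
        (λ u w uw → ≤-resp-≈ (≈-trans (scale-+ (P x u) (P x w)) (+-cong (P-swap u) (P-swap w))) ≈-refl
                      (scale-mono (P+P≤X x uw)))
        where
        P-swap : ∀ u → scale (P x u) ≈ scale (P u x)
        P-swap u = reflexive (≡.cong scale (P-sym x u))

      complement-in-cone : ∀ x → cone R (ESTAB R G) (λ j → column R Y zero j - column R Y (suc x) j)
      complement-in-cone x = cone-ESTAB (λ j → column R Y zero j - column R Y (suc x) j)
        (≤⇒0≤- (scale-mono (X≤N x)))
        (λ u → ≤⇒0≤- (scale-mono (P≤X u x)))
        (λ u → scale-difference {X u} {P u x} {N} {X x}
          (≡.subst (λ p → X u ℕ.+ X x ℕ.≤ N ℕ.+ p) (P-sym x u) (X+X≤N+P x u)))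
        (λ u w uw → scale-difference₂ {X u} {X w} {P u x} {P w x} {N} {X x}
          (≡.subst₂ (λ p q → X u ℕ.+ X w ℕ.+ X x ℕ.≤ N ℕ.+ (p ℕ.+ q)) (P-sym x u) (P-sym x w)
            (X+X+X≤N+P+P x uw)))

      point : Point R n
      point u = scale (X u)

      point-LS₊ : LS₊ R (ESTAB R G) point
      point-LS₊ =
        (λ u → scale-nonNeg (X u) , ≤-resp-≈ ≈-refl ND≈1 (scale-mono (X≤N u))) ,
        Y , (Y-psd , diagonal , λ x → column-in-cone x , complement-in-cone x) ,
        ND≈1 , λ u → ≈-refl
        where
        diagonal : ∀ j → Y j zero ≈ Y j j
        diagonal zero    = ≈-refl
        diagonal (suc u) = reflexive (≡.cong scale (≡.sym (P-diagonal u)))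

      point-sum : sum point ≈ ι 2 + ι 2 * D
      point-sum = begin-equality
        sum (λ u → ι (X u) * D)          ≈⟨ *-distribʳ-sum D (ι ∘ X) ⟨
        sum (ι ∘ X) * D                  ≈⟨ *-congʳ (ι-sum X) ⟨
        ι (ΣN.sum X) * D                 ≡⟨ ≡.cong (λ k → ι k * D) ΣX ⟩
        ι (2 ℕ.* N ℕ.+ 2) * D            ≈⟨ *-congʳ (≈-trans (ι-+ (2 ℕ.* N) 2) (+-congʳ (ι-* 2 N))) ⟩
        (ι 2 * ι N + ι 2) * D            ≈⟨ solve 2 (λ n d → (con (+ 2) :* n :+ con (+ 2)) :* d :=
                                              con (+ 2) :* (n :* d) :+ con (+ 2) :* d) ≈-refl (ι N) D ⟩
        ι 2 * (ι N * D) + ι 2 * D        ≈⟨ +-congʳ (≈-trans (*-congˡ ND≈1) (*-identityʳ _)) ⟩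
        ι 2 + ι 2 * D                    ∎

    -- `D` is 1 / N, so the LS₊ point has coordinate sum 2 + 2 / N. Membership in `STAB` bounds this
    -- sum by 2 and would force `D` to be zero.
    pendant⇒imperfect : (∀ S → Stable G S → ∣ S ∣ ℕ.≤ 2) → ¬ LS₊-Perfect R G
    pendant⇒imperfect α≤2 perfect = 0≉1 (≈-trans (≈-sym (≈-trans (*-congˡ D≈0) (zeroʳ _))) ND≈1)
      where
      2D≤0 : ι 2 * D ≤ 0#
      2D≤0 = +-cancelʳ-≤ (ι 2) (≤-resp-≈ (≈-trans point-sum (+-comm _ _)) (≈-sym (+-identityˡ _))
               (STAB-sum α≤2 (proj₁ perfect point-LS₊)))
      D≈0 : D ≈ 0#
      D≈0 = x*y≈0⇒y≈0 (λ ι2≈0 → contradiction (ι-cancel-≤ {2} {0} (≤-reflexive ι2≈0)) λ ())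
              (≤-antisym 2D≤0 (*-nonNeg (0≤ι 2) 0≤D))

  -- Rotating the cycle moves any of its vertices to position zero.
  odd-cycle-closed : (∀ S → Stable G S → ∣ S ∣ ℕ.≤ 2) → LS₊-Perfect R G →
    ∀ {m′} → 4 ℕ.≤ m′ → sgn m′ ≈ 1# → ∀ a {c : Fin (suc m′) → Fin n} → Injective _≡_ _≡_ c →
    (∀ a → Adj (complement G) (c a) (c (cpred a))) →
    ∀ {v} → (∀ a → c a ≢ v) → ¬ Adj (complement G) v (c a)
  odd-cycle-closed α≤2 perfect {m′} m′≥4 m′-even = >-weakInduction Closed
      -- `cpred` sends `zero` to the last index and `suc i` to `inject₁ i`. One rotation thus moves
      -- the last position to `zero`, and the induction descends from there.
      (λ inj adj c≢v → base (cpred-injective ∘ inj) (adj ∘ cpred) (c≢v ∘ cpred))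
      (λ i closed inj adj c≢v → closed (cpred-injective ∘ inj) (adj ∘ cpred) (c≢v ∘ cpred))
    where
    Closed : Fin (suc m′) → Set
    Closed a = ∀ {c : Fin (suc m′) → Fin n} → Injective _≡_ _≡_ c →
      (∀ a → Adj (complement G) (c a) (c (cpred a))) →
      ∀ {v} → (∀ a → c a ≢ v) → ¬ Adj (complement G) v (c a)
    base : Closed zero
    base inj adj c≢v vt = pendant⇒imperfect m′≥4 m′-even inj adj c≢v vt α≤2 perfect

-- Odd closed walks, induced odd cycles and two-colourings.

module OddCycles where

  open import Data.Nat.Base using (_+_; _*_; _≤_; _<_)

  odd : ℕ → Bool
  odd zero    = false
  odd (suc k) = not (odd k)

  odd-+ : ∀ k l → odd (k + l) ≡ odd k xor odd l
  odd-+ zero    l = refl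
  odd-+ (suc k) l rewrite odd-+ k l with odd k
  ... | true  = Bool.not-involutive (odd l)
  ... | false = refl

  even⇒double : ∀ k → odd k ≡ false → ∃[ h ] k ≡ 2 * h
  even⇒double zero _ = 0 , refl
  even⇒double (suc (suc k)) even with even⇒double k (trans (sym (Bool.not-involutive (odd k))) even)
  ... | h , refl = suc h , sym (ℕ.*-suc 2 h)

  odd-summand : ∀ k l → odd (k + l) ≡ true → odd k ≡ true ⊎ odd l ≡ true
  odd-summand k l o rewrite odd-+ k l with odd k
  ... | true  = inj₁ refl
  ... | false = inj₂ o

  -- Reconciles the modular successor in `cycle` with `cpred`; the remainder wraps to zero exactly
  -- at the last index.
  CyclicSuc⇒cpred : ∀ {k} {i j : Fin (3 + k)} → CyclicSuc i j → i ≡ cpred j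
  CyclicSuc⇒cpred {k} {i} {j} j≡ with suc (toℕ i) ℕ.≟ 3 + k
  CyclicSuc⇒cpred {k} {i} {zero} j≡ | yes last =
    toℕ-injective (trans (ℕ.suc-injective last) (sym (toℕ-fromℕ (2 + k))))
  CyclicSuc⇒cpred {k} {i} {suc j} j≡ | yes last =
    contradiction (trans j≡ (trans (cong (_% (3 + k)) last) (n%n≡0 (3 + k)))) λ ()
  CyclicSuc⇒cpred {k} {i} {j} j≡ | no ¬last
    with trans j≡ (m<n⇒m%n≡m (ℕ.≤∧≢⇒< (toℕ<n i) ¬last))
  CyclicSuc⇒cpred {k} {i} {suc j} j≡ | no ¬last | eq =
    toℕ-injective (trans (sym (ℕ.suc-injective eq)) (sym (toℕ-inject₁ j)))

  module Walks {n} (H : Graph (Fin n)) where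

    infixr 5 _∷_ _++_

    data Walk : Fin n → Fin n → ℕ → Set where
      []  : ∀ {u} → Walk u u 0
      _∷_ : ∀ {u v w k} → Adj H u v → Walk v w k → Walk u w (suc k)

    _++_ : ∀ {u v w k l} → Walk u v k → Walk v w l → Walk u w (k + l)
    []      ++ q = q
    (e ∷ p) ++ q = e ∷ (p ++ q)

    reverse : ∀ {u v k} → Walk u v k → Walk v u k
    reverse [] = []
    reverse {k = suc k} (e ∷ p) =
      subst (Walk _ _) (ℕ.+-comm k 1) (reverse p ++ (Graph.~-sym H e ∷ []))

    preserves : ∀ {ℓ} {P : Fin n → Set ℓ} → (∀ {u v} → Adj H u v → P u → P v) →
                ∀ {u v k} → Walk u v k → P u → P v
    preserves closed []      Pu = Pu
    preserves closed (e ∷ p) Pu = preserves closed p (closed e Pu)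

    -- The final vertex is left out, so that a closed walk of length k is indexed cyclically by
    -- `Fin k`.
    at : ∀ {u w k} → Walk u w k → Fin k → Fin n
    at {u} (e ∷ p) zero = u
    at (e ∷ p) (suc i)  = at p i

    at-step : ∀ {u w k} (p : Walk u w (suc k)) i → Adj H (at p (inject₁ i)) (at p (suc i))
    at-step (e ∷ e′ ∷ p) zero    = e
    at-step (e ∷ e′ ∷ p) (suc i) = at-step (e′ ∷ p) i

    at-last : ∀ {u w k} (p : Walk u w (suc k)) → Adj H (at p (fromℕ k)) w
    at-last (e ∷ [])     = e
    at-last (e ∷ e′ ∷ p) = at-last (e′ ∷ p)

    at-zero : ∀ {u w k} (p : Walk u w (suc k)) → at p zero ≡ u
    at-zero (e ∷ p) = refl

    at-cpred : ∀ {u k} (p : Walk u u (suc k)) i → Adj H (at p (cpred i)) (at p i)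
    at-cpred p zero    = subst (Adj H _) (sym (at-zero p)) (at-last p)
    at-cpred p (suc i) = at-step p i

    prefix : ∀ {u w k} (p : Walk u w k) i → Walk u (at p i) (toℕ i)
    prefix (e ∷ p) zero    = []
    prefix (e ∷ p) (suc i) = e ∷ prefix p i

    suffix : ∀ {u w k} (p : Walk u w k) i → ∃[ r ] Walk (at p i) w (suc r) × toℕ i + suc r ≡ k
    suffix (e ∷ p) zero = _ , e ∷ p , refl
    suffix (e ∷ p) (suc i) with suffix p i
    ... | r , q , eq = r , q , cong suc eq

    infix-walk : ∀ {u w k} (p : Walk u w k) i j → toℕ i < toℕ j →
                 ∃[ q ] Walk (at p i) (at p j) (suc q) × toℕ i + suc q ≡ toℕ j
    infix-walk (e ∷ p) zero (suc j) _ = toℕ j , e ∷ prefix p j , refl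
    infix-walk (e ∷ p) (suc i) (suc j) (s≤s i<j) with infix-walk p i j i<j
    ... | q , b , eq = q , b , cong suc eq

    record InducedOddCycle : Set where
      field
        k         : ℕ
        c         : Fin (3 + (2 + 2 * k)) → Fin n
        injective : Injective _≡_ _≡_ c
        c-adj     : ∀ i → Adj H (c (cpred i)) (c i)
        chordless : ∀ i j → Adj H (c i) (c j) → Adj (cycle (2 + 2 * k)) i j

    module _ (triangle-free : ∀ {u v w} → Adj H u v → Adj H v w → ¬ Adj H u w)
             {P : Fin n → Set} (P-closed : ∀ {u v} → Adj H u v → P u → P v) where

      InducedOddCycleIn : Set
      InducedOddCycleIn = Σ[ C ∈ InducedOddCycle ] ∀ i → P (InducedOddCycle.c C i)

      private
        ShorterOddWalk : ℕ → Set
        ShorterOddWalk m = ∃[ u ] ∃[ l ] l < m × odd l ≡ true × Walk u u l × P u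

        module _ {u k} (p : Walk u u (3 + k)) (odd-p : odd (3 + k) ≡ true) (Pu : P u) where

          Chord : Fin (3 + k) → Fin (3 + k) → Set
          Chord i j = Adj H (at p i) (at p j) × ¬ Adj (cycle k) i j

          module _ {i j : Fin (3 + k)} (i<j : i Fin.< j) where
            a = toℕ i
            A = prefix p i
            q = proj₁ (infix-walk p i j i<j)
            B = proj₁ (proj₂ (infix-walk p i j i<j))
            r = proj₁ (suffix p j)
            C = proj₁ (proj₂ (suffix p j))

            a+q≡j : a + suc q ≡ toℕ j
            a+q≡j = proj₂ (proj₂ (infix-walk p i j i<j))

            j+r≡m : toℕ j + suc r ≡ 3 + k
            j+r≡m = proj₂ (proj₂ (suffix p j))

            m≡ : a + suc q + suc r ≡ 3 + k
            m≡ = trans (cong (_+ suc r) a+q≡j) j+r≡m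

            m≡2+ : suc (suc (q + (a + r))) ≡ 3 + k
            m≡2+ = trans
              (solve 3 (λ a q r → con 2 :+ (q :+ (a :+ r)) := a :+ (con 1 :+ q) :+ (con 1 :+ r)) refl a q r) m≡
              where open +-*-Solver

            Pi : P (at p i)
            Pi = preserves P-closed A Pu

            -- A repeated vertex cuts the closed walk into two nonempty closed walks. Their lengths
            -- add up to an odd number, so one of them is odd, and it is shorter.
            shorten-repeat : at p i ≡ at p j → ShorterOddWalk (3 + k)
            shorten-repeat i≡j with odd-summand (suc q) (a + suc r)
              (trans (cong odd (trans (solve 3 (λ a q r → con 1 :+ q :+ (a :+ (con 1 :+ r)) :=
                  con 2 :+ (q :+ (a :+ r))) refl a q r) m≡2+)) odd-p)
              where open +-*-Solver
            ... | inj₁ odd-B = at p i , suc q ,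
              subst (suc q <_) m≡2+ (s≤s (s≤s (ℕ.m≤m+n q (a + r)))) , odd-B ,
              subst (λ x → Walk (at p i) x (suc q)) (sym i≡j) B , Pi
            ... | inj₂ odd-AC = u , a + suc r ,
              ≡.subst₂ _<_ (sym (ℕ.+-suc a r)) m≡2+ (s≤s (s≤s (ℕ.m≤n+m (a + r) q))) , odd-AC ,
              A ++ subst (λ x → Walk x u (suc r)) (sym i≡j) C , Pu

            -- The chord closes both arcs, and the two lengths add up to the old length plus 2, so
            -- one is odd. It could fail to be shorter only if the opposite arc were a single edge,
            -- and then i and j would be cyclically consecutive.
            shorten-chord : Chord i j → ShorterOddWalk (3 + k)
            shorten-chord (ij , ¬cyclic) with odd-summand (suc (suc q)) (a + suc (suc r))
              (trans (cong odd (trans (solve 3 (λ a q r → con 2 :+ q :+ (a :+ (con 2 :+ r)) :=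
                  con 2 :+ (con 2 :+ (q :+ (a :+ r)))) refl a q r) (cong (λ l → suc (suc l)) m≡2+)))
                (trans (Bool.not-involutive (odd (3 + k))) odd-p))
              where open +-*-Solver
            ... | inj₁ odd-B = at p j , suc (suc q) ,
              subst (suc (suc q) <_) m≡2+ (s≤s (s≤s (ℕ.m<m+n q (ℕ.n≢0⇒n>0 a+r≢0)))) , odd-B ,
              Graph.~-sym H ij ∷ B , P-closed ij Pi
              where
              a+r≢0 : a + r ≢ 0
              a+r≢0 a+r≡0 = ¬cyclic (inj₂ (trans (ℕ.m+n≡0⇒m≡0 a a+r≡0)
                (sym (trans (cong (_% (3 + k)) last) (n%n≡0 (3 + k))))))
                where
                last : suc (toℕ j) ≡ 3 + k
                last = trans (sym (ℕ.+-comm (toℕ j) 1))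
                  (trans (cong (λ r → toℕ j + suc r) (sym (ℕ.m+n≡0⇒n≡0 a a+r≡0))) j+r≡m)
            ... | inj₂ odd-AC = u , a + suc (suc r) ,
              ≡.subst₂ _<_ (sym (trans (ℕ.+-suc a (suc r)) (cong suc (ℕ.+-suc a r)))) m≡2+
                (s≤s (s≤s (ℕ.+-monoˡ-≤ (a + r) (ℕ.n≢0⇒n>0 q≢0)))) , odd-AC ,
              A ++ ij ∷ C , Pu
              where
              q≢0 : q ≢ 0
              q≢0 q≡0 = ¬cyclic (inj₁ (trans next (sym (m<n⇒m%n≡m (subst (_< 3 + k) next (toℕ<n j))))))
                where
                next : toℕ j ≡ suc (toℕ i)
                next = trans (sym a+q≡j) (trans (cong (λ q → a + suc q) q≡0) (ℕ.+-comm a 1))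

          Shortcut : Fin (3 + k) → Fin (3 + k) → Set
          Shortcut i j = i Fin.< j × (at p i ≡ at p j ⊎ Chord i j)

          shortcut? : Dec (∃[ i ] ∃[ j ] Shortcut i j)
          shortcut? = any? λ i → any? λ j → (i <ᶠ? j) ×-dec
            ((at p i ≟ at p j) ⊎-dec (Graph.~-dec H _ _ ×-dec ¬? (Graph.~-dec (cycle k) i j)))

          shorten : ∃[ i ] ∃[ j ] Shortcut i j → ShorterOddWalk (3 + k)
          shorten (i , j , i<j , inj₁ i≡j)   = shorten-repeat i<j i≡j
          shorten (i , j , i<j , inj₂ chord) = shorten-chord i<j chord

          module _ (none : ¬ (∃[ i ] ∃[ j ] Shortcut i j)) where

            at-injective : Injective _≡_ _≡_ (at p)
            at-injective {i} {j} i≡j with <-cmp i j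
            ... | tri< i<j _ _ = contradiction (i , j , i<j , inj₁ i≡j) none
            ... | tri≈ _ i≡j _ = i≡j
            ... | tri> _ _ i>j = contradiction (j , i , i>j , inj₁ (sym i≡j)) none

            at-chordless : ∀ i j → Adj H (at p i) (at p j) → Adj (cycle k) i j
            at-chordless i j ij with <-cmp i j
            ... | tri< i<j _ _ = decidable-stable (Graph.~-dec (cycle k) i j)
                    λ ¬cyclic → none (i , j , i<j , inj₂ (ij , ¬cyclic))
            ... | tri≈ _ refl _ = contradiction ij (Graph.~-irrefl H)
            ... | tri> _ _ i>j = Graph.~-sym (cycle k) (decidable-stable (Graph.~-dec (cycle k) j i)
                    λ ¬cyclic → none (j , i , i>j , inj₂ (Graph.~-sym H ij , ¬cyclic)))

            at-inside : ∀ i → P (at p i)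
            at-inside i = preserves P-closed (prefix p i) Pu

      -- Descent on the length. A walk without shortcuts is injective and chordless; length 1 would
      -- be a loop and length 3 a triangle. The invariant `P` keeps the cycle inside a prescribed
      -- union of components.
      induced-odd-cycle : ∀ {u m} → Acc _<_ m → Walk u u m → odd m ≡ true → P u → InducedOddCycleIn
      induced-odd-cycle {m = suc zero} _ (e ∷ []) _ _ = contradiction e (Graph.~-irrefl H)
      induced-odd-cycle {m = suc (suc (suc k))} (acc rec) p odd-p Pu with shortcut? p odd-p Pu
      ... | yes found = let _ , _ , l<m , odd-l , p′ , Pu′ = shorten p odd-p Pu found in
                        induced-odd-cycle (rec l<m) p′ odd-l Pu′
      ... | no none = build k p odd-p none
        where
        build : ∀ k (p : Walk _ _ (3 + k)) (o : odd (3 + k) ≡ true) →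
                ¬ (∃[ i ] ∃[ j ] Shortcut p o Pu i j) → InducedOddCycleIn
        build zero (e ∷ e′ ∷ e″ ∷ []) _ _ = contradiction (Graph.~-sym H e″) (triangle-free e e′)
        build (suc zero) _ ()
        build (suc (suc k)) p o none with even⇒double k (Bool.not-injective (trans
          (sym (trans (Bool.not-involutive (not (not (not (odd k))))) (Bool.not-involutive (not (odd k))))) o))
        ... | h , refl = record
          { k         = h
          ; c         = at p
          ; injective = at-injective p o Pu none
          ; c-adj     = at-cpred p
          ; chordless = at-chordless p o Pu none
          } , at-inside p o Pu none

    module TwoColouring (v : Fin n) where

      Colouring : Set
      Colouring = Fin n → Maybe Bool

      _≟ᶜ_ = ≡-dec Bool._≟_

      -- A colour is the parity of some walk to v, so an edge whose ends have equal colours closes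
      -- two such walks into an odd closed walk at v.
      Sound : Colouring → Set
      Sound f = ∀ {u b} → f u ≡ just b → ∃[ k ] Walk u v k × odd k ≡ b

      Proper : Colouring → Set
      Proper f = ∀ {u w} → Adj H u w →
        (f u ≡ nothing × f w ≡ nothing) ⊎ (∃[ b ] f u ≡ just b × f w ≡ just (not b))

      OddClosedWalk : Set
      OddClosedWalk = ∃[ k ] Walk v v k × odd k ≡ true

      Result : Set
      Result = OddClosedWalk ⊎ (∃[ f ] Sound f × Proper f × f v ≡ just false)

      private
        blank : Maybe Bool → ℕ
        blank nothing  = 1
        blank (just _) = 0

        blanks : Colouring → ℕ
        blanks f = ΣN.sum (blank ∘ f)

        Extensible : Colouring → Set
        Extensible f = ∃[ u ] ∃[ w ] Adj H u w × f u ≢ nothing × f w ≡ nothing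

        Conflict : Colouring → Set
        Conflict f = ∃[ u ] ∃[ w ] Adj H u w × f u ≢ nothing × f u ≡ f w

        extensible? : ∀ f → Dec (Extensible f)
        extensible? f = any? λ u → any? λ w →
          Graph.~-dec H u w ×-dec ¬? (f u ≟ᶜ nothing) ×-dec (f w ≟ᶜ nothing)

        conflict? : ∀ f → Dec (Conflict f)
        conflict? f = any? λ u → any? λ w →
          Graph.~-dec H u w ×-dec ¬? (f u ≟ᶜ nothing) ×-dec (f u ≟ᶜ f w)

        closing : ∀ {f} → Sound f → Conflict f → OddClosedWalk
        closing {f} sound (u , w , uw , fu≢ , fu≡fw) with f u in fu
        ... | nothing = contradiction refl fu≢
        ... | just b with sound fu | sound (sym fu≡fw)
        ...   | k , p , odd-k | l , q , odd-l = k + suc l , reverse p ++ uw ∷ q , (begin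
          odd (k + suc l)          ≡⟨ odd-+ k (suc l) ⟩
          odd k xor not (odd l)    ≡⟨ ≡.cong₂ (λ x y → x xor not y) odd-k odd-l ⟩
          b xor not b              ≡⟨ xor-not b ⟩
          true                     ∎)
          where
          open ≡.≡-Reasoning
          xor-not : ∀ b → b xor not b ≡ true
          xor-not true  = refl
          xor-not false = refl

        proper : ∀ {f} → ¬ Extensible f → ¬ Conflict f → Proper f
        proper {f} ¬ext ¬con {u} {w} uw with f u in fu | f w in fw
        ... | nothing | nothing = inj₁ (refl , refl)
        ... | nothing | just b  = contradiction
          (w , u , Graph.~-sym H uw , (λ eq → contradiction (trans (sym fw) eq) λ ()) , fu) ¬ext
        ... | just b | nothing = contradiction
          (u , w , uw , (λ eq → contradiction (trans (sym fu) eq) λ ()) , fw) ¬ext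
        ... | just b | just b′ = inj₂ (b , refl , cong just (Bool.¬-not λ b′≡b → ¬con
          (u , w , uw , (λ eq → contradiction (trans (sym fu) eq) λ ()) ,
           trans fu (trans (cong just (sym b′≡b)) (sym fw)))))

        -- Every round colours one blank neighbour of a coloured vertex, so the number of blanks
        -- decreases. When none is left, no edge leaves the coloured set, and absence of a conflict
        -- makes the colouring proper.
        search : ∀ f → Acc _<_ (blanks f) → Sound f → f v ≡ just false → Result
        search f (acc rec) sound fv with extensible? f
        ... | no ¬ext with conflict? f
        ...   | yes con = inj₁ (closing sound con)
        ...   | no ¬con = inj₂ (f , sound , proper ¬ext ¬con , fv)
        search f (acc rec) sound fv | yes (u , w , uw , fu≢ , fw≡) with f u in fu
        ... | nothing = contradiction refl fu≢
        ... | just b = search f′ (rec fewer) sound′ fv′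
          where
          f′ : Colouring
          f′ = updateAt f w (const (just (not b)))

          f′w : f′ w ≡ just (not b)
          f′w = updateAt-updates w f

          f′-other : ∀ {x} → x ≢ w → f′ x ≡ f x
          f′-other {x} x≢w = updateAt-minimal x w f x≢w

          fewer : blanks f′ < blanks f
          fewer = sumℕ-strict {f = blank ∘ f′} {g = blank ∘ f} le w
            (≡.subst₂ (λ x y → blank x < blank y) (sym f′w) (sym fw≡) (s≤s z≤n))
            where
            le : ∀ x → blank (f′ x) ≤ blank (f x)
            le x with x ≟ w
            ... | yes refl rewrite f′w = z≤n
            ... | no x≢w rewrite f′-other x≢w = ℕ.≤-refl

          sound′ : Sound f′
          sound′ {x} {b′} f′x with x ≟ w
          ... | no x≢w = sound (trans (sym (f′-other x≢w)) f′x)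
          ... | yes refl with sound fu
          ...   | k , p , odd-k = suc k , Graph.~-sym H uw ∷ p ,
            trans (cong not odd-k) (just-injective (trans (sym f′w) f′x))

          fv′ : f′ v ≡ just false
          fv′ with v ≟ w
          ... | yes refl = contradiction (trans (sym fv) fw≡) λ ()
          ... | no v≢w = trans (f′-other v≢w) fv

      result : Result
      result = search f₀ (<-wellFounded _) sound (updateAt-updates v (const nothing))
        where
        f₀ : Colouring
        f₀ = updateAt (const nothing) v (const (just false))
        sound : Sound f₀
        sound {u} {b} fu with u ≟ v
        ... | yes refl = 0 , [] , just-injective (trans (sym (updateAt-updates v (const nothing))) fu)
        ... | no u≢v = contradiction (trans (sym (updateAt-minimal u v (const nothing) u≢v)) fu) λ ()

open OddCycles

-- Decidable subsets as finite index sets, for the vertices of the clique.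

record Enumeration {n} (P : Fin n → Set) : Set where
  field
    size       : ℕ
    element    : Fin size → Fin n
    injective  : Injective _≡_ _≡_ element
    member     : ∀ j → P (element j)
    surjective : ∀ u → P u → ∃[ j ] element j ≡ u

enumerate : ∀ {n} {P : Fin n → Set} → Decidable P → Enumeration P
enumerate {zero} P? = record
  { size = 0 ; element = λ () ; injective = λ {} ; member = λ () ; surjective = λ () }
enumerate {suc n} {P} P? with P? zero | enumerate {n} {P ∘ suc} (P? ∘ suc)
... | no ¬P0 | rest = record
  { size       = size
  ; element    = suc ∘ element
  ; injective  = injective ∘ suc-injective
  ; member     = member
  ; surjective = λ where
      zero P0    → contradiction P0 ¬P0
      (suc u) Pu → let j , eq = surjective u Pu in j , cong suc eq
  }
  where open Enumeration rest
... | yes P0 | rest = record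
  { size       = suc size
  ; element    = element′
  ; injective  = λ {i} {j} → injective′ i j
  ; member     = λ { zero → P0 ; (suc j) → member j }
  ; surjective = λ where
      zero P0    → zero , refl
      (suc u) Pu → let j , eq = surjective u Pu in suc j , cong suc eq
  }
  where
  open Enumeration rest
  element′ : Fin (suc size) → Fin (suc n)
  element′ zero    = zero
  element′ (suc j) = suc (element j)
  injective′ : ∀ i j → element′ i ≡ element′ j → i ≡ j
  injective′ zero    zero    _  = refl
  injective′ (suc i) (suc j) eq = cong suc (injective (suc-injective eq))

-- The components of the complement and the join decomposition.

module Components where

  open import Data.Nat.Base using (_+_; _*_; _≤_; _<_)

  module StabilityNumberTwo {n} (G : Graph (Fin n)) (α≡2 : HasStabilityNumber G 2) where

    private
      H = complement G
      α≤2 = proj₂ α≡2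

    triangle-free : ∀ {u v w} → Adj H u v → Adj H v w → ¬ Adj H u w
    triangle-free {u} {v} {w} (u≢v , ¬uv) (v≢w , ¬vw) (u≢w , ¬uw) = ℕ.<⇒≱ 2<∣S∣ (α≤2 S stable)
      where
      S = (⁅ u ⁆ ∪ ⁅ v ⁆) ∪ ⁅ w ⁆

      cases : ∀ {x} → x ∈ₛ S → x ≡ u ⊎ x ≡ v ⊎ x ≡ w
      cases x∈ with x∈p∪q⁻ (⁅ u ⁆ ∪ ⁅ v ⁆) ⁅ w ⁆ x∈
      ... | inj₂ x∈w = inj₂ (inj₂ (x∈⁅y⁆⇒x≡y w x∈w))
      ... | inj₁ x∈uv with x∈p∪q⁻ ⁅ u ⁆ ⁅ v ⁆ x∈uv
      ...   | inj₁ x∈u = inj₁ (x∈⁅y⁆⇒x≡y u x∈u)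
      ...   | inj₂ x∈v = inj₂ (inj₁ (x∈⁅y⁆⇒x≡y v x∈v))

      stable : Stable G S
      stable x y x∈ y∈ xy with cases x∈ | cases y∈
      ... | inj₁ refl | inj₁ refl = Graph.~-irrefl G xy
      ... | inj₁ refl | inj₂ (inj₁ refl) = ¬uv xy
      ... | inj₁ refl | inj₂ (inj₂ refl) = ¬uw xy
      ... | inj₂ (inj₁ refl) | inj₁ refl = ¬uv (Graph.~-sym G xy)
      ... | inj₂ (inj₁ refl) | inj₂ (inj₁ refl) = Graph.~-irrefl G xy
      ... | inj₂ (inj₁ refl) | inj₂ (inj₂ refl) = ¬vw xy
      ... | inj₂ (inj₂ refl) | inj₁ refl = ¬uw (Graph.~-sym G xy)
      ... | inj₂ (inj₂ refl) | inj₂ (inj₁ refl) = ¬vw (Graph.~-sym G xy)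
      ... | inj₂ (inj₂ refl) | inj₂ (inj₂ refl) = Graph.~-irrefl G xy

      2≤∣uv∣ : 2 ≤ ∣ ⁅ u ⁆ ∪ ⁅ v ⁆ ∣
      2≤∣uv∣ = subst (_< ∣ ⁅ u ⁆ ∪ ⁅ v ⁆ ∣) (∣⁅x⁆∣≡1 u) (p⊂q⇒∣p∣<∣q∣
        (p⊆p∪q ⁅ v ⁆ , v , x∈p∪q⁺ (inj₂ (x∈⁅x⁆ v)) , λ v∈u → u≢v (sym (x∈⁅y⁆⇒x≡y u v∈u))))

      2<∣S∣ : 2 < ∣ S ∣
      2<∣S∣ = ℕ.≤-<-trans 2≤∣uv∣ (p⊂q⇒∣p∣<∣q∣
        (p⊆p∪q ⁅ w ⁆ , w , x∈p∪q⁺ (inj₂ (x∈⁅x⁆ w)) , λ w∈uv →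
          [ (λ w∈u → u≢w (sym (x∈⁅y⁆⇒x≡y u w∈u))) , (λ w∈v → v≢w (sym (x∈⁅y⁆⇒x≡y v w∈v))) ]
            (x∈p∪q⁻ ⁅ u ⁆ ⁅ v ⁆ w∈uv)))

    nonadjacent-pair : ∃[ u ] ∃[ w ] Adj H u w
    nonadjacent-pair with proj₁ α≡2
    ... | S , stable , ∣S∣≡2 with any? (_∈? S)
    ...   | no empty = contradiction (subst (_≤ 0) ∣S∣≡2 (subst (∣ S ∣ ≤_) (∣⊥∣≡0 n)
              (p⊆q⇒∣p∣≤∣q∣ {p = S} {q = ∅} (λ {x} x∈S → contradiction (x , x∈S) empty)))) λ ()
    ...   | yes (u , u∈S) with any? (λ w → (w ∈? S) ×-dec ¬? (w ≟ u))
    ...     | yes (w , w∈S , w≢u) = u , w , w≢u ∘ sym , stable u w u∈S w∈S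
    ...     | no alone = contradiction (subst (_≤ 1) ∣S∣≡2 (subst (∣ S ∣ ≤_) (∣⁅x⁆∣≡1 u)
                (p⊆q⇒∣p∣≤∣q∣ {p = S} {q = ⁅ u ⁆} λ {x} x∈S →
                  subst (_∈ₛ ⁅ u ⁆) (sym (decidable-stable (x ≟ u) λ x≢u → alone (x , x∈S , x≢u))) (x∈⁅x⁆ u))))
                λ { (s≤s ()) }

    n>1 : 1 < n
    n>1 with nonadjacent-pair
    ... | u , w , u≢w , _ = lemma u w u≢w
      where
      lemma : ∀ {n} (u w : Fin n) → u ≢ w → 1 < n
      lemma {suc zero} zero zero u≢w = contradiction refl u≢w
      lemma {suc (suc n)} _ _ _ = s≤s (s≤s z≤n)

  module Decomposition {ℓ₀ ℓ₁ ℓ₂} (R : RealField ℓ₀ ℓ₁ ℓ₂) {n} (G : Graph (Fin n))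
    (α≡2 : HasStabilityNumber G 2) (facet-defining : FacetDefining R G)
    (perfect : LS₊-Perfect R G) where

    open RealField R using
      ( 0#; 1#; -_; _≈_; 0≉1; ≈-refl; ≈-sym; ≈-trans
      ; +-identityˡ; -‿inverseˡ; -‿inverseʳ; reflexive)
      renaming (_+_ to _⊕_; Carrier to 𝕂)
    open FieldProperties R using (module Solver)
    open QuadraticForm R using (sgn; sgn-double)
    open StableSetPolytope R G
    open LS₊-Imperfection R G
    open StabilityNumberTwo G α≡2

    private
      H = complement G
    open Walks H

    odd-closed-walk : ∀ {v w} → Adj H v w → ∃[ k ] Walk v v k × odd k ≡ true
    odd-closed-walk {v} {w} vw with TwoColouring.result v
    ... | inj₁ walk = walk
    ... | inj₂ (f , sound , proper , fv) = contradiction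
          (≈-sym (≈-trans (reflexive (cong value (sym fv)))
            (Facet.alternating⇒0 facet support n>1 triangle-free (value ∘ f) alternating isolated v))) 0≉1
      where
      facet   = proj₁ (proj₂ (proj₂ facet-defining))
      support = proj₂ (proj₂ (proj₂ facet-defining))

      value : Maybe Bool → 𝕂
      value nothing      = 0#
      value (just false) = 1#
      value (just true)  = - 1#

      alternating : ∀ {u w} → Adj H u w → value (f u) ⊕ value (f w) ≈ 0#
      alternating uw with proper uw
      ... | inj₁ (fu , fw) rewrite fu | fw = +-identityˡ 0#
      ... | inj₂ (false , fu , fw) rewrite fu | fw = -‿inverseʳ 1#
      ... | inj₂ (true  , fu , fw) rewrite fu | fw = -‿inverseˡ 1#

      isolated : ∀ u → (∀ w → ¬ Adj H u w) → value (f u) ≈ 0#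
      isolated u none with f u in fu
      ... | nothing = ≈-refl
      ... | just b with sound fu
      -- Only the empty walk leaves an isolated vertex, so a coloured one would be v, which has the
      -- neighbour `w`.
      ...   | zero  , []    , _ = contradiction vw (none w)
      ...   | suc _ , e ∷ _ , _ = contradiction e (none _)

    open InducedOddCycle using (k; c)

    cycle-closed : ∀ (C : InducedOddCycle) a {w} → Adj H (c C a) w → ∃[ b ] c C b ≡ w
    cycle-closed C a {w} aw with any? (λ b → c C b ≟ w)
    ... | yes found = found
    ... | no none = contradiction (Graph.~-sym H aw)
          (odd-cycle-closed (proj₂ α≡2) perfect (s≤s (s≤s (s≤s (s≤s z≤n)))) even a
            (InducedOddCycle.injective C) (λ b → Graph.~-sym H (InducedOddCycle.c-adj C b))
            (λ b b≡w → none (b , b≡w)))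
      where
      open Solver using (solve; :-_; _:=_)
      even : sgn (4 + 2 * k C) ≈ 1#
      even = ≈-trans (solve 1 (λ s → :- :- :- :- s := s) ≈-refl _) (sgn-double (k C))

    record Family (r : ℕ) : Set where
      field
        F        : Fin r → InducedOddCycle
        disjoint : ∀ {i j a b} → c (F i) a ≡ c (F j) b → i ≡ j

      Covered : Fin n → Set
      Covered u = ∃[ i ] ∃[ a ] c (F i) a ≡ u

      covered? : Decidable Covered
      covered? u = any? λ i → any? λ a → c (F i) a ≟ u

      uncovered-closed : ∀ {u w} → Adj H u w → ¬ Covered u → ¬ Covered w
      uncovered-closed uw ¬cov-u (i , a , refl) with cycle-closed (F i) a (Graph.~-sym H uw)
      ... | b , eq = ¬cov-u (i , b , eq)

      -- The vertices at index `zero` represent the cycles distinctly; this is what makes the greedy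
      -- extension stop.
      r≤n : r ≤ n
      r≤n = injective⇒≤ {f = λ i → c (F i) zero} disjoint

      Complete : Set
      Complete = ∀ u → ¬ Covered u → ∀ w → ¬ Adj H u w

    open Family

    -- Uncovered vertices have only uncovered H-neighbours, so the descent from an odd closed walk
    -- at `u` stays among them and ends in a cycle disjoint from the family.
    extend : ∀ {r} (𝓕 : Family r) {u w} → ¬ Covered 𝓕 u → Adj H u w → Family (suc r)
    extend {r} 𝓕 {u} ¬cov-u uw = record { F = C Vector.∷ F 𝓕 ; disjoint = λ {i} {j} → disjoint′ i j }
      where
      found = let _ , p , odd-p = odd-closed-walk uw in
        induced-odd-cycle triangle-free {P = λ x → ¬ Covered 𝓕 x} (uncovered-closed 𝓕)
          (<-wellFounded _) p odd-p ¬cov-u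
      C = proj₁ found
      fresh = proj₂ found
      disjoint′ : ∀ i j {a b} → c ((C Vector.∷ F 𝓕) i) a ≡ c ((C Vector.∷ F 𝓕) j) b → i ≡ j
      disjoint′ zero    zero    _ = refl
      disjoint′ zero    (suc j) {a} {b} eq = contradiction (j , b , sym eq) (fresh a)
      disjoint′ (suc i) zero    {a} {b} eq = contradiction (i , a , eq) (fresh b)
      disjoint′ (suc i) (suc j) eq = cong suc (disjoint 𝓕 eq)

    -- The fuel counts the extensions still possible; at zero the family would have n + 1 cycles,
    -- against `r≤n`.
    complete-family : ∀ fuel {r} → Family r → r + fuel ≡ suc n → ∃[ r ] Σ[ 𝓕 ∈ Family r ] Complete 𝓕
    complete-family zero {r} 𝓕 r≡ =
      contradiction (ℕ.≤-trans (ℕ.≤-reflexive (trans (sym r≡) (ℕ.+-identityʳ r))) (r≤n 𝓕)) (ℕ.1+n≰n)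
    complete-family (suc fuel) {r} 𝓕 r≡
      with any? (λ u → any? λ w → ¬? (covered? 𝓕 u) ×-dec Graph.~-dec H u w)
    ... | yes (u , w , ¬cov , uw) =
          complete-family fuel (extend 𝓕 ¬cov uw) (trans (sym (ℕ.+-suc r fuel)) r≡)
    ... | no none = r , 𝓕 , λ u ¬cov w uw → none (u , w , ¬cov , uw)

    module _ {r} (𝓕 : Family r) (complete : Complete 𝓕) where

      private
        module E = Enumeration (enumerate {P = λ u → ¬ Covered 𝓕 u} (λ u → ¬? (covered? 𝓕 u)))

      size : Fin (suc r) → ℕ
      size zero    = E.size
      size (suc i) = 3 + (2 + 2 * k (F 𝓕 i))

      part : ∀ i → Graph (Fin (size i))
      part zero    = record
        { _~_ = _≢_ ; ~-dec = λ u v → ¬? (u ≟ v)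
        ; ~-sym = λ u≢v → u≢v ∘ sym ; ~-irrefl = λ v≢v → v≢v refl }
      part (suc i) = complement (cycle (2 + 2 * k (F 𝓕 i)))

      vertex : Σ (Fin (suc r)) (Fin ∘ size) → Fin n
      vertex (zero  , j) = E.element j
      vertex (suc i , a) = c (F 𝓕 i) a

      vertex-injective : ∀ p q → vertex p ≡ vertex q → p ≡ q
      vertex-injective (zero  , j) (zero  , l) eq = cong (zero ,_) (E.injective eq)
      vertex-injective (zero  , j) (suc i , a) eq = contradiction (i , a , sym eq) (E.member j)
      vertex-injective (suc i , a) (zero  , j) eq = contradiction (i , a , eq) (E.member j)
      vertex-injective (suc i , a) (suc j , b) eq with disjoint 𝓕 eq
      ... | refl = cong (suc i ,_) (InducedOddCycle.injective (F 𝓕 i) eq)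

      locate : ∀ u → ∃[ p ] vertex p ≡ u
      locate u with covered? 𝓕 u
      ... | yes (i , a , eq) = (suc i , a) , eq
      ... | no ¬cov with E.surjective u ¬cov
      ...   | j , eq = (zero , j) , eq

      vertices : Fin n ↔ Σ (Fin (suc r)) (Fin ∘ size)
      vertices = mk↔ₛ′ (proj₁ ∘ locate) vertex
        (λ p → vertex-injective _ _ (proj₂ (locate (vertex p)))) (proj₂ ∘ locate)

      Adj-stable : ∀ {u v} → u ≢ v → ¬ Adj H u v → Adj G u v
      Adj-stable {u} {v} u≢v ¬Huv = decidable-stable (Graph.~-dec G u v) λ ¬uv → ¬Huv (u≢v , ¬uv)

      -- An H-edge from a cycle ends on the same cycle by `cycle-closed`, and uncovered vertices
      -- have no H-edges at all.
      across-adjacent : ∀ i j x y → i ≢ j → Adj G (vertex (i , x)) (vertex (j , y))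
      across-adjacent i j x y i≢j = Adj-stable
        (λ eq → i≢j (cong proj₁ (vertex-injective _ _ eq))) (not-in-complement i x i≢j)
        where
        not-in-complement : ∀ i′ x′ → i′ ≢ j → ¬ Adj H (vertex (i′ , x′)) (vertex (j , y))
        not-in-complement zero     x′ _ = complete _ (E.member x′) _
        not-in-complement (suc i′) x′ i≢j xy with cycle-closed (F 𝓕 i′) x′ xy
        ... | b , eq = i≢j (cong proj₁ (vertex-injective (suc i′ , b) (j , y) eq))

      cycle-edge : ∀ (C : InducedOddCycle) {a b} → Adj (cycle (2 + 2 * k C)) a b → Adj H (c C a) (c C b)
      cycle-edge C {a} {b} (inj₁ ab) =
        subst (λ x → Adj H (c C x) (c C b)) (sym (CyclicSuc⇒cpred {i = a} {j = b} ab)) (InducedOddCycle.c-adj C b)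
      cycle-edge C (inj₂ ba) = Graph.~-sym H (cycle-edge C (inj₁ ba))

      within-to : ∀ i x y → Adj G (vertex (i , x)) (vertex (i , y)) → Adj (part i) x y
      within-to zero    x y xy refl = Graph.~-irrefl G xy
      within-to (suc i) x y xy = (λ { refl → Graph.~-irrefl G xy }) ,
        λ cyclic → proj₂ (cycle-edge (F 𝓕 i) cyclic) xy

      within-from : ∀ i x y → Adj (part i) x y → Adj G (vertex (i , x)) (vertex (i , y))
      within-from zero    x y x≢y = Adj-stable (x≢y ∘ E.injective) (complete _ (E.member x) _)
      within-from (suc i) x y (x≢y , ¬cyclic) = Adj-stable
        (x≢y ∘ InducedOddCycle.injective (F 𝓕 i)) (¬cyclic ∘ InducedOddCycle.chordless (F 𝓕 i) x y)

      join-to : ∀ p q → Adj G (vertex p) (vertex q) → Adj (completeJoin part) p q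
      join-to (i , x) (j , y) xy with i ≟ j
      ... | yes refl = within (within-to i x y xy)
      ... | no i≢j   = across i≢j

      join-from : ∀ p q → Adj (completeJoin part) p q → Adj G (vertex p) (vertex q)
      join-from (i , x) (j , y) (across i≢j) = across-adjacent i j x y i≢j
      join-from (i , x) (_ , y) (within xy)  = within-from i x y xy

      join : G ≅ completeJoin part
      join = vertices , λ u v → mk⇔
        (λ uv → join-to _ _ (≡.subst₂ (Adj G) (sym (proj₂ (locate u))) (sym (proj₂ (locate v))) uv))
        (λ pq → ≡.subst₂ (Adj G) (proj₂ (locate u)) (proj₂ (locate v)) (join-from _ _ pq))

      antihole : ∀ i → IsOddAntihole (part (suc i))
      antihole i = k (F 𝓕 i) , ↔-id _ , λ u v → ⇔-id _

    decomposition : IsJoinOfOddAntiholesAndClique G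
    decomposition with complete-family (suc n) {0} (record { F = λ () ; disjoint = λ { {()} } }) refl
    -- With no cycle in a complete family, H would be edgeless, but a stable set of size 2 is an
    -- edge of H. So at least one antihole occurs.
    ... | zero , 𝓕 , complete =
      let u , w , uw = nonadjacent-pair in contradiction uw (complete u (λ ()) w)
    ... | suc r , 𝓕 , complete =
      r , size 𝓕 complete , part 𝓕 complete , (λ u v u≢v → u≢v) , antihole 𝓕 complete , join 𝓕 complete

open Components

theorem6 : ∀ {c ℓ₁ ℓ₂} (R : RealField c ℓ₁ ℓ₂) {n : ℕ} (G : Graph (Fin n)) →
    HasStabilityNumber G 2 → FacetDefining R G → LS₊-Perfect R G →
    IsOddAntihole G ⊎ IsJoinOfOddAntiholesAndClique G
theorem6 R G α≡2 facet-defining perfect =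
  -- A single odd antihole is the join of one antihole with an empty clique, so this alternative
  -- covers it too.
  inj₂ (Decomposition.decomposition R G α≡2 facet-defining perfect)
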